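{- Let $G$ be a finite nilpotent group of odd order, written additively (not necessarily commutative), and let $p$ be the smallest prime dividing $|G|$. If $|G|/p$ is a composite number, then $cr(G)=|G|/p+p-2$.
   Context: For a finite additively written group $G$ with identity $0$ and a subset $S=\{a_1,\dots,a_k\}\subseteq G\setminus\{0\}$, let $\sum(S)=\{a_{i_1}+\cdots+a_{i_l} : 1\le l\le k,\ i_1,\dots,i_l \text{ pairwise distinct}\}$ (all sums of distinct elements of $S$, taken in any order). $S$ is an additive basis of $G$ if $\sum(S)=G$. The critical number $cr(G)$ is the smallest integer $t$ such that every subset $S\subseteq G\setminus\{0\}$ with $|S|\ge t$ is an additive basis of $G$. -}

module Defs where

open import Data.Nat using (ℕ; zero; suc; _<_; _≥_; _∸_; _+_; _*_)
open import Data.Nat.Divisibility using (_∣_)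
open import Data.Nat.Primality using (Prime; Composite)
open import Data.Fin using (Fin)
open import Data.Fin.Subset using (Subset; _∈_; _∉_; ∣_∣)
open import Data.List using (List; []; _∷_; foldr)
open import Data.List.Relation.Unary.All using (All)
open import Data.List.Relation.Unary.Unique.Propositional using (Unique)
open import Data.Product using (Σ; ∃; _×_; _,_)
open import Data.Unit using (⊤)
open import Relation.Nullary using (¬_)
open import Relation.Binary.PropositionalEquality using (_≡_)

record FiniteGroup (n : ℕ) : Set where
  field
    _⊕_   : Fin n → Fin n → Fin n
    𝟘     : Fin n
    ⊖_    : Fin n → Fin n
    assoc   : ∀ x y z → (x ⊕ y) ⊕ z ≡ x ⊕ (y ⊕ z)
    identˡ  : ∀ x → 𝟘 ⊕ x ≡ x
    identʳ  : ∀ x → x ⊕ 𝟘 ≡ x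
    inverseˡ : ∀ x → (⊖ x) ⊕ x ≡ 𝟘
    inverseʳ : ∀ x → x ⊕ (⊖ x) ≡ 𝟘
  infixl 6 _⊕_

module _ {n : ℕ} (G : FiniteGroup n) where
  open FiniteGroup G

  data Gen (P : Fin n → Set) : Fin n → Set where
    gen  : ∀ {x} → P x → Gen P x
    gen0 : Gen P 𝟘
    gen+ : ∀ {x y} → Gen P x → Gen P y → Gen P (x ⊕ y)
    gen- : ∀ {x} → Gen P x → Gen P (⊖ x)

  comm : Fin n → Fin n → Fin n
  comm a b = (⊖ a) ⊕ (⊖ b) ⊕ a ⊕ b

  γ : ℕ → Fin n → Set
  γ zero    _ = ⊤
  γ (suc i) = Gen (λ x → Σ (Fin n) λ a → Σ (Fin n) λ b → γ i a × x ≡ comm a b)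

  Nilpotent : Set
  Nilpotent = ∃ λ c → ∀ g → γ c g → g ≡ 𝟘

  sumL : List (Fin n) → Fin n
  sumL []       = 𝟘
  sumL (x ∷ xs) = x ⊕ sumL xs

  InSums : Subset n → Fin n → Set
  InSums S g = Σ (List (Fin n)) λ xs →
    (xs ≢[]) × Unique xs × All (_∈ S) xs × sumL xs ≡ g
    where
      _≢[] : List (Fin n) → Set
      [] ≢[] = ¬ ⊤
      (_ ∷ _) ≢[] = ⊤

  IsAdditiveBasis : Subset n → Set
  IsAdditiveBasis S = ∀ g → InSums S g

  CritProp : ℕ → Set
  CritProp t = ∀ (S : Subset n) → 𝟘 ∉ S → ∣ S ∣ ≥ t → IsAdditiveBasis S

  CriticalNumberIs : ℕ → Set
  CriticalNumberIs t = CritProp t × (∀ t′ → t′ < t → ¬ CritProp t′)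

{-# OPTIONS --safe #-}
module Submission where

-- Lower bound: a normal subgroup of index p without 𝟘, together with p − 2 elements of one of its cosets, is not a basis.
--
-- Upper bound: along a central series K < K′ < … with prime indices, keep a set T of unused elements of S such that the sums
-- of elements of S ∖ T fill a coset of K. A set of elements of T in one K′-coset that are pairwise distinct modulo K
-- ("slice"), from which one element is to be chosen, adds a subset of K′ / K; an element of T ∩ K′ outside K, which may be
-- used or not, adds a subset with two elements. By Cauchy–Davenport these fill K′ / K once the gains |slice| − 1 add up to
-- the index r. Elements of T are lost only in a controlled way: |T ∖ K| + |K| does not decrease once |K| > 1, and
-- there are enough slices at every level as long as |T ∖ K| + |K| ≥ m + p − 1 (or ≥ m if only primes above p remain).
-- In a nilpotent group the primes of the series can be taken in any order, so K₁ of order p comes first. This settles the case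
-- p ∤ m. If p ∣ m, then K₂ of order p² is next; the passage from K₁ to K₂ is tight and
-- depends on whether S fills half of K₂ and whether S contains full K₁-cosets outside K₂.

open import Defs
open import Algebra.Bundles using (Group)
import Algebra.Properties.Group
import Algebra.Properties.Monoid.Mult
open import Data.Bool using (true; false)
open import Data.Empty using (⊥; ⊥-elim)
open import Data.Fin using (Fin; zero; suc; toℕ; fromℕ; fromℕ<; inject₁)
import Data.Fin.Properties as Fin
open import Data.Fin.Subset using (Subset; ∣_∣) renaming (_∈_ to _∈ˢ_)
import Data.Fin.Subset.Properties as Subset
open import Data.List using (List; []; _∷_; length; filter; map; allFin; take; _++_; upTo)
import Data.List.Properties as List
open import Data.List.Membership.Propositional using (find) renaming (_∈_ to _∈ₗ_)
import Data.List.Membership.Propositional.Properties as Mem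
open import Data.List.Relation.Unary.All as All using (All; []; _∷_)
import Data.List.Relation.Unary.All.Properties as All
open import Data.List.Relation.Unary.AllPairs as AllPairs using (AllPairs; []; _∷_)
import Data.List.Relation.Unary.AllPairs.Properties as AllPairs
open import Data.List.Relation.Unary.Any as Any using (Any; here; there)
import Data.List.Relation.Unary.Any.Properties as Any
open import Data.List.Relation.Unary.Unique.Propositional using (Unique)
import Data.List.Relation.Unary.Unique.Propositional.Properties as Unique
open import Data.Nat using (ℕ; zero; suc; _+_; _*_; _∸_; _≤_; _<_; z≤n; s≤s; _≤?_; _<?_; _⊓_; _≟_)
open import Data.Nat.Base using (NonZero; s≤s⁻¹; >-nonZero; >-nonZero⁻¹; ≢-nonZero; nonTrivial⇒n>1)
open import Data.Nat.Coprimality using (Coprime; coprime-Bézout; coprime-divisor; prime⇒coprime)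
open import Data.Nat.Divisibility hiding (quotient)
open import Data.Nat.DivMod using (_%_; _/_; m≡m%n+[m/n]*n; m%n<n)
open import Data.Nat.GCD using (module Bézout)
open import Data.Nat.Induction using (<-rec)
open import Data.Nat.Primality
open import Data.Nat.Properties hiding (_≟_)
open import Data.Nat.Tactic.RingSolver using (solve-∀)
open import Data.Product using (Σ; ∃; _,_; proj₁; proj₂) renaming (_×_ to _⊗_)
open import Data.Sum as Sum using (_⊎_; inj₁; inj₂)
open import Data.Unit using (⊤; tt)
import Data.Vec as Vec
import Data.Vec.Properties as Vec
open import Function using (_∘_; id; case_of_)
open import Level using (0ℓ)
open import Relation.Binary using (tri<; tri≈; tri>)
open import Relation.Binary.PropositionalEquality
import Relation.Binary.Reasoning.Setoid
open import Relation.Nullary using (¬_; Dec; does; yes; no; contradiction)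
open import Relation.Nullary.Decidable using (¬?; _×-dec_; _⊎-dec_; _→-dec_; dec-true)
open import Relation.Unary using (Decidable)

-- A slice gives up k ≥ 2 elements of T for a gain of k - 1, so at most 2 per unit of gain. With y =
-- |T ∩ (K′ ∖ K)|, the set T ∖ K loses at most y + 2(r - 1 - y) elements if y < r, which the (r -
-- 1)|K| new elements of K′ cover once |K| ≥ 2. The step from the trivial subgroup to K₁ has no such
-- compensation: it may lower the guaranteed value of |T ∖ K| + |K| from m + p - 1 to m. Enough
-- slices exist at K if |T ∖ K| + |K| ≥ r + k - 1, where n = r k: at worst each of the k / |K| - 1
-- outer K′-cosets needs |K| slices. Always r + k ≤ m + p, with equality for r = p, and r + k ≤ m +
-- 1 if r > p; hence the two thresholds. So a second step of index p asks for p - 1 more than K₁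
-- guarantees. If S has no full K₁-coset outside K₂, every outer K₂-coset saves a slice, and there
-- are at least p - 1 of them. A full K₁-coset makes the first step cheaper, p elements of S in all,
-- so that only one slice has to be saved.

record DSet (n : ℕ) : Set₁ where
  constructor dset
  field
    mem  : Fin n → Set
    mem? : Decidable mem

open DSet

infix 4 _∈_ _∉_ _⊆_
infixl 7 _∩_ _∖_

_∈_ _∉_ : ∀ {n} → Fin n → DSet n → Set
x ∈ P = mem P x
x ∉ P = ¬ (x ∈ P)

_⊆_ : ∀ {n} → DSet n → DSet n → Set
P ⊆ Q = ∀ {x} → x ∈ P → x ∈ Q

_∩_ _∖_ : ∀ {n} → DSet n → DSet n → DSet n
mem (P ∩ Q) x = x ∈ P ⊗ x ∈ Q
mem? (P ∩ Q) x = mem? P x ×-dec mem? Q x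
mem (P ∖ Q) x = x ∈ P ⊗ x ∉ Q
mem? (P ∖ Q) x = mem? P x ×-dec ¬? (mem? Q x)

⟪_⟫ : ∀ {n} → List (Fin n) → DSet n
mem ⟪ xs ⟫ x = x ∈ₗ xs
mem? ⟪ xs ⟫ x = Any.any? (Fin._≟_ x) xs

full : ∀ n → DSet n
mem (full n) _ = ⊤
mem? (full n) _ = yes _

-- Opaque, so that unification never compares the decision procedures.
abstract
  elems : ∀ {n} → DSet n → List (Fin n)
  elems P = filter (mem? P) (allFin _)

  elems-! : ∀ {n} (P : DSet n) → Unique (elems P)
  elems-! P = Unique.filter⁺ (mem? P) (Unique.allFin⁺ _)

  elems⁺ : ∀ {n} (P : DSet n) {x} → x ∈ P → x ∈ₗ elems P
  elems⁺ P = Mem.∈-filter⁺ (mem? P) (Mem.∈-allFin _)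

  elems⁻ : ∀ {n} (P : DSet n) {x} → x ∈ₗ elems P → x ∈ P
  elems⁻ P x∈ = proj₂ (Mem.∈-filter⁻ (mem? P) {xs = allFin _} x∈)

elems-All : ∀ {n} (P : DSet n) → All (_∈ P) (elems P)
elems-All P = All.tabulate (elems⁻ P)

-- Cardinalities of decidable subsets

count : ∀ {n} → DSet n → ℕ
count P = length (elems P)

unique-⊆⇒length≤ : ∀ {A : Set} {xs ys : List A} → Unique xs → (∀ {x} → x ∈ₗ xs → x ∈ₗ ys) →
                   length xs ≤ length ys
unique-⊆⇒length≤ {xs = []} _ _ = z≤n
unique-⊆⇒length≤ {xs = x ∷ xs} (x∉ ∷ u) sub with Mem.∈-∃++ (sub (here refl))
... | as , bs , refl = begin
    suc (length xs)          ≤⟨ s≤s (unique-⊆⇒length≤ u sub′) ⟩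
    suc (length (as ++ bs))  ≡⟨ cong suc (List.length-++ as) ⟩
    suc (length as + length bs) ≡⟨ +-suc (length as) (length bs) ⟨
    length as + suc (length bs) ≡⟨ List.length-++ as ⟨
    length (as ++ x ∷ bs) ∎
  where
  open ≤-Reasoning
  sub′ : ∀ {y} → y ∈ₗ xs → y ∈ₗ as ++ bs
  sub′ y∈ with Mem.∈-++⁻ as (sub (there y∈))
  ... | inj₁ q = Mem.∈-++⁺ˡ q
  ... | inj₂ (here refl) = contradiction refl (All.lookup x∉ y∈)
  ... | inj₂ (there q) = Mem.∈-++⁺ʳ as q

length≤count : ∀ {n} {xs} (P : DSet n) → Unique xs → All (_∈ P) xs → length xs ≤ count P
length≤count P u a = unique-⊆⇒length≤ u (λ x∈ → elems⁺ P (All.lookup a x∈))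

count-image : ∀ {n k} (P : DSet n) (Q : DSet k) (f : Fin n → Fin k) →
              (∀ {x y} → f x ≡ f y → x ≡ y) → (∀ {x} → x ∈ P → f x ∈ Q) → count P ≤ count Q
count-image P Q f inj into = begin
    count P                 ≡⟨ List.length-map f (elems P) ⟨
    length (map f (elems P)) ≤⟨ length≤count Q (Unique.map⁺ inj (elems-! P)) (All.map⁺ (All.map into (elems-All P))) ⟩
    count Q ∎
  where open ≤-Reasoning

count-mono : ∀ {n} (P Q : DSet n) → P ⊆ Q → count P ≤ count Q
count-mono P Q = count-image P Q id id

count-cong : ∀ {n} (P Q : DSet n) → P ⊆ Q → Q ⊆ P → count P ≡ count Q
count-cong P Q p q = ≤-antisym (count-mono P Q p) (count-mono Q P q)

count-⊎ : ∀ {n} (P Q R : DSet n) → (∀ {x} → x ∈ P → x ∈ Q ⊎ x ∈ R) → Q ⊆ P → R ⊆ P →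
          (∀ {x} → x ∈ Q → x ∉ R) → count P ≡ count Q + count R
count-⊎ P Q R split Q⊆ R⊆ disjoint = trans (≤-antisym
    (unique-⊆⇒length≤ (elems-! P) λ x∈ → case split (elems⁻ P x∈) of λ where
      (inj₁ q) → Mem.∈-++⁺ˡ (elems⁺ Q q)
      (inj₂ r) → Mem.∈-++⁺ʳ (elems Q) (elems⁺ R r))
    (length≤count P (Unique.++⁺ (elems-! Q) (elems-! R) (λ (q , r) → disjoint (elems⁻ Q q) (elems⁻ R r)))
      (All.++⁺ (All.map Q⊆ (elems-All Q)) (All.map R⊆ (elems-All R)))))
  (List.length-++ (elems Q))

count-∖ : ∀ {n} (P Q : DSet n) → count P ≡ count (P ∩ Q) + count (P ∖ Q)
count-∖ P Q = count-⊎ P (P ∩ Q) (P ∖ Q) c proj₁ proj₁ (λ (_ , q) (_ , nq) → nq q)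
  where
  c : ∀ {x} → x ∈ P → x ∈ P ∩ Q ⊎ x ∈ P ∖ Q
  c {x} p with mem? Q x
  ... | yes q = inj₁ (p , q)
  ... | no nq = inj₂ (p , nq)

count-full : ∀ n → count (full n) ≡ n
count-full n = trans (≤-antisym
    (unique-⊆⇒length≤ (elems-! (full n)) λ _ → Mem.∈-allFin _)
    (length≤count (full n) (Unique.allFin⁺ n) (All.tabulate λ _ → _)))
  (List.length-tabulate id)

count-list : ∀ {n} {xs : List (Fin n)} → Unique xs → count ⟪ xs ⟫ ≡ length xs
count-list {xs = xs} u = ≤-antisym
  (unique-⊆⇒length≤ (elems-! ⟪ xs ⟫) (elems⁻ ⟪ xs ⟫))
  (length≤count ⟪ xs ⟫ u (All.tabulate id))

count-< : ∀ {n} (P Q : DSet n) → P ⊆ Q → ∀ {x} → x ∈ Q → x ∉ P → count P < count Q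
count-< P Q sub x∈Q x∉P =
  length≤count Q (All.tabulate (λ { y∈ refl → x∉P (elems⁻ P y∈) }) ∷ elems-! P) (x∈Q ∷ All.map sub (elems-All P))

count-⊆-≡ : ∀ {n} (P Q : DSet n) → P ⊆ Q → count Q ≤ count P → Q ⊆ P
count-⊆-≡ P Q sub le {x} q with mem? P x
... | yes p = p
... | no np = contradiction le (<⇒≱ (count-< P Q sub q np))

count≡0 : ∀ {n} (P : DSet n) → (∀ x → x ∉ P) → count P ≡ 0
count≡0 P e with elems P in eq
... | [] = refl
... | x ∷ _ = contradiction (elems⁻ P (subst (x ∈ₗ_) (sym eq) (here refl))) (e x)

count>0 : ∀ {n} (P : DSet n) {x} → x ∈ P → 0 < count P
count>0 P p with elems P | elems⁺ P p
... | _ ∷ _ | _ = s≤s z≤n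

count>0⁻ : ∀ {n} (P : DSet n) → 0 < count P → ∃ (_∈ P)
count>0⁻ P pos with elems P in eq
... | x ∷ _ = x , elems⁻ P (subst (x ∈ₗ_) (sym eq) (here refl))

count-∖-list : ∀ {n} (P : DSet n) (xs : List (Fin n)) → Unique xs → count P ≤ count (P ∖ ⟪ xs ⟫) + length xs
count-∖-list P xs u = begin
    count P                                  ≡⟨ count-∖ P ⟪ xs ⟫ ⟩
    count (P ∩ ⟪ xs ⟫) + count (P ∖ ⟪ xs ⟫)  ≤⟨ +-monoˡ-≤ _ (count-mono (P ∩ ⟪ xs ⟫) ⟪ xs ⟫ proj₂) ⟩
    count ⟪ xs ⟫ + count (P ∖ ⟪ xs ⟫)        ≡⟨ cong (_+ count (P ∖ ⟪ xs ⟫)) (count-list u) ⟩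
    length xs + count (P ∖ ⟪ xs ⟫)           ≡⟨ +-comm (length xs) _ ⟩
    count (P ∖ ⟪ xs ⟫) + length xs ∎
  where open ≤-Reasoning

∈-take : ∀ {A : Set} k {x : A} {xs} → x ∈ₗ take k xs → x ∈ₗ xs
∈-take (suc k) {xs = _ ∷ _} (here eq) = here eq
∈-take (suc k) {xs = _ ∷ _} (there x∈) = there (∈-take k x∈)

-- Certificate for a linear inequality: the hypotheses are added up to `x ≤ y`, `s` is the slack,
-- and the last argument is an identity for the ring solver.
linarith : ∀ {a b x y} s → x ≤ y → a + y + s ≡ b + x → a ≤ b
linarith {a} {b} {x} {y} s x≤y eq = +-cancelʳ-≤ x a b (begin
    a + x      ≤⟨ +-monoʳ-≤ a x≤y ⟩
    a + y      ≤⟨ m≤m+n (a + y) s ⟩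
    a + y + s  ≡⟨ eq ⟩
    b + x ∎)
  where open ≤-Reasoning

-- Normal subgroups, quotients and central extensions of prime index

module GroupTheory {n : ℕ} (G : FiniteGroup n) where
  open FiniteGroup G

  group : Group 0ℓ 0ℓ
  group = record
    { Carrier = Fin n ; _≈_ = _≡_ ; _∙_ = _⊕_ ; ε = 𝟘 ; _⁻¹ = ⊖_
    ; isGroup = record
      { isMonoid = record
        { isSemigroup = record
          { isMagma = record { isEquivalence = isEquivalence ; ∙-cong = cong₂ _⊕_ }
          ; assoc = assoc }
        ; identity = identˡ , identʳ }
      ; inverse = inverseˡ , inverseʳ
      ; ⁻¹-cong = cong ⊖_ } }

  open Algebra.Properties.Group group public
    using (⁻¹-anti-homo-∙; ⁻¹-involutive; ε⁻¹≈ε; \\-leftDividesˡ; \\-leftDividesʳ; //-rightDividesˡ; //-rightDividesʳ)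
    renaming (∙-cancelˡ to ⊕-cancelˡ; ∙-cancelʳ to ⊕-cancelʳ)
  open Algebra.Properties.Monoid.Mult (Group.monoid group) public using (_×_; ×-homo-+; ×-assocˡ)

  record NormalSubgroup : Set₁ where
    field
      set   : DSet n
      0∈    : 𝟘 ∈ set
      ⊕∈    : ∀ {x y} → x ∈ set → y ∈ set → x ⊕ y ∈ set
      ⊖∈    : ∀ {x} → x ∈ set → ⊖ x ∈ set
      conj∈ : ∀ g {x} → x ∈ set → g ⊕ x ⊕ ⊖ g ∈ set

    order : ℕ
    order = count set

  trivial : NormalSubgroup
  trivial = record
    { set = dset (_≡ 𝟘) (Fin._≟ 𝟘)
    ; 0∈ = refl
    ; ⊕∈ = λ { refl refl → identˡ 𝟘 }
    ; ⊖∈ = λ { refl → ε⁻¹≈ε }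
    ; conj∈ = λ { g refl → trans (cong (_⊕ ⊖ g) (identʳ g)) (inverseʳ g) }
    }

  order-trivial : NormalSubgroup.order trivial ≡ 1
  order-trivial = trans (count-cong (NormalSubgroup.set trivial) ⟪ 𝟘 ∷ [] ⟫ here (λ { (here eq) → eq }))
                        (count-list {xs = 𝟘 ∷ []} ([] ∷ []))

  module Mod (K : NormalSubgroup) where
    open NormalSubgroup K

    infix 4 _≈_ _≈?_
    _≈_ : Fin n → Fin n → Set
    x ≈ y = ⊖ x ⊕ y ∈ set

    _≈?_ : ∀ x y → Dec (x ≈ y)
    x ≈? y = mem? set (⊖ x ⊕ y)

    ≈-refl : ∀ {x} → x ≈ x
    ≈-refl {x} = subst (_∈ set) (sym (inverseˡ x)) 0∈

    ≈-sym : ∀ {x y} → x ≈ y → y ≈ x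
    ≈-sym {x} {y} p = subst (_∈ set) eq (⊖∈ p)
      where
      eq : ⊖ (⊖ x ⊕ y) ≡ ⊖ y ⊕ x
      eq = trans (⁻¹-anti-homo-∙ (⊖ x) y) (cong (⊖ y ⊕_) (⁻¹-involutive x))

    ≈-trans : ∀ {x y z} → x ≈ y → y ≈ z → x ≈ z
    ≈-trans {x} {y} {z} p q = subst (_∈ set) eq (⊕∈ p q)
      where
      eq : (⊖ x ⊕ y) ⊕ (⊖ y ⊕ z) ≡ ⊖ x ⊕ z
      eq = trans (assoc (⊖ x) y _) (cong (⊖ x ⊕_) (\\-leftDividesˡ y z))

    ⊕-cong : ∀ {x x′ y y′} → x ≈ x′ → y ≈ y′ → x ⊕ y ≈ x′ ⊕ y′
    ⊕-cong {x} {x′} {y} {y′} p q = subst (_∈ set) eq (⊕∈ (conj∈ (⊖ y) p) q)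
      where
      open ≡-Reasoning
      eq : (⊖ y ⊕ (⊖ x ⊕ x′) ⊕ ⊖ ⊖ y) ⊕ (⊖ y ⊕ y′) ≡ ⊖ (x ⊕ y) ⊕ (x′ ⊕ y′)
      eq = begin
        (⊖ y ⊕ (⊖ x ⊕ x′) ⊕ ⊖ ⊖ y) ⊕ (⊖ y ⊕ y′) ≡⟨ assoc _ (⊖ ⊖ y) _ ⟩
        ⊖ y ⊕ (⊖ x ⊕ x′) ⊕ (⊖ ⊖ y ⊕ (⊖ y ⊕ y′)) ≡⟨ cong (⊖ y ⊕ (⊖ x ⊕ x′) ⊕_) (\\-leftDividesʳ (⊖ y) y′) ⟩
        ⊖ y ⊕ (⊖ x ⊕ x′) ⊕ y′                   ≡⟨ cong (_⊕ y′) (assoc (⊖ y) (⊖ x) x′) ⟨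
        ⊖ y ⊕ ⊖ x ⊕ x′ ⊕ y′                     ≡⟨ assoc _ x′ y′ ⟩
        ⊖ y ⊕ ⊖ x ⊕ (x′ ⊕ y′)                   ≡⟨ cong (_⊕ (x′ ⊕ y′)) (⁻¹-anti-homo-∙ x y) ⟨
        ⊖ (x ⊕ y) ⊕ (x′ ⊕ y′) ∎

    ⊖-cong : ∀ {x y} → x ≈ y → ⊖ x ≈ ⊖ y
    ⊖-cong {x} {y} p = subst (_∈ set) eq (conj∈ x (≈-sym p))
      where
      open ≡-Reasoning
      eq : x ⊕ (⊖ y ⊕ x) ⊕ ⊖ x ≡ ⊖ ⊖ x ⊕ ⊖ y
      eq = begin
        x ⊕ (⊖ y ⊕ x) ⊕ ⊖ x  ≡⟨ cong (_⊕ ⊖ x) (assoc x (⊖ y) x) ⟨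
        x ⊕ ⊖ y ⊕ x ⊕ ⊖ x    ≡⟨ //-rightDividesʳ x (x ⊕ ⊖ y) ⟩
        x ⊕ ⊖ y              ≡⟨ cong (_⊕ ⊖ y) (⁻¹-involutive x) ⟨
        ⊖ ⊖ x ⊕ ⊖ y ∎

    ≡⇒≈ : ∀ {x y} → x ≡ y → x ≈ y
    ≡⇒≈ refl = ≈-refl

    -- The carrier stays `Fin n` and only the equality changes, so that sums computed in G are at
    -- the same time sums in G / K.
    quotient : Group 0ℓ 0ℓ
    quotient = record
      { Carrier = Fin n ; _≈_ = _≈_ ; _∙_ = _⊕_ ; ε = 𝟘 ; _⁻¹ = ⊖_
      ; isGroup = record
        { isMonoid = record
          { isSemigroup = record
            { isMagma = record
              { isEquivalence = record { refl = ≈-refl ; sym = ≈-sym ; trans = ≈-trans }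
              ; ∙-cong = ⊕-cong }
            ; assoc = λ x y z → ≡⇒≈ (assoc x y z) }
          ; identity = (λ x → ≡⇒≈ (identˡ x)) , λ x → ≡⇒≈ (identʳ x) }
        ; inverse = (λ x → ≡⇒≈ (inverseˡ x)) , λ x → ≡⇒≈ (inverseʳ x)
        ; ⁻¹-cong = ⊖-cong } }

    ×-congʳ : ∀ k {x y} → x ≈ y → k × x ≈ k × y
    ×-congʳ zero    e = ≈-refl
    ×-congʳ (suc k) e = ⊕-cong e (×-congʳ k e)

    module ≈-Reasoning = Relation.Binary.Reasoning.Setoid (Group.setoid quotient)

    ∈⇒≈0 : ∀ {x} → x ∈ set → 𝟘 ≈ x
    ∈⇒≈0 {x} = subst (_∈ set) (sym (trans (cong (_⊕ x) ε⁻¹≈ε) (identˡ x)))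

    ≈0⇒∈ : ∀ {x} → 𝟘 ≈ x → x ∈ set
    ≈0⇒∈ {x} = subst (_∈ set) (trans (cong (_⊕ x) ε⁻¹≈ε) (identˡ x))

    ≈-cancelˡ : ∀ g {x y} → g ⊕ x ≈ g ⊕ y → x ≈ y
    ≈-cancelˡ g {x} {y} = Algebra.Properties.Group.∙-cancelˡ quotient g x y

    coset : Fin n → DSet n
    mem (coset w) g = w ≈ g
    mem? (coset w) g = w ≈? g

    count-coset : ∀ w → count (coset w) ≡ order
    count-coset w = ≤-antisym
      (count-image (coset w) set (⊖ w ⊕_) (⊕-cancelˡ (⊖ w) _ _) id)
      (count-image set (coset w) (w ⊕_) (⊕-cancelˡ w _ _) (subst (_∈ set) (sym (\\-leftDividesʳ w _))))

    ×-∈ : ∀ k {x} → x ∈ set → k × x ∈ set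
    ×-∈ zero    x∈ = 0∈
    ×-∈ (suc k) x∈ = ⊕∈ x∈ (×-∈ k x∈)

    coprime-annihilates : ∀ {i j x} → Coprime i j → i × x ∈ set → j × x ∈ set → x ∈ set
    coprime-annihilates {i} {j} {x} cop ix jx with coprime-Bézout cop
    ... | Bézout.+- a b eq = ≈0⇒∈ (lemma a i b j eq ix jx)
      where
      lemma : ∀ a i b j → 1 + b * j ≡ a * i → i × x ∈ set → j × x ∈ set → 𝟘 ≈ x
      lemma a i b j eq ix jx = begin
        𝟘                ≈⟨ ∈⇒≈0 (×-∈ a ix) ⟩
        a × (i × x)      ≡⟨ ×-assocˡ x a i ⟩
        (a * i) × x      ≡⟨ cong (_× x) eq ⟨
        x ⊕ (b * j) × x  ≡⟨ cong (x ⊕_) (×-assocˡ x b j) ⟨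
        x ⊕ b × (j × x)  ≈⟨ ⊕-cong ≈-refl (∈⇒≈0 (×-∈ b jx)) ⟨
        x ⊕ 𝟘            ≡⟨ identʳ x ⟩
        x ∎
        where open ≈-Reasoning
    ... | Bézout.-+ a b eq = ≈0⇒∈ (begin
        𝟘                ≈⟨ ∈⇒≈0 (×-∈ b jx) ⟩
        b × (j × x)      ≡⟨ ×-assocˡ x b j ⟩
        (b * j) × x      ≡⟨ cong (_× x) eq ⟨
        x ⊕ (a * i) × x  ≡⟨ cong (x ⊕_) (×-assocˡ x a i) ⟨
        x ⊕ a × (i × x)  ≈⟨ ⊕-cong ≈-refl (∈⇒≈0 (×-∈ a ix)) ⟨
        x ⊕ 𝟘            ≡⟨ identʳ x ⟩
        x ∎)
        where open ≈-Reasoning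

    Central : Fin n → Set
    Central x = ∀ g → x ⊕ g ≈ g ⊕ x

    central-resp : ∀ {x y} → x ≈ y → Central x → Central y
    central-resp {x} {y} e c g = begin
      y ⊕ g ≈⟨ ⊕-cong e ≈-refl ⟨
      x ⊕ g ≈⟨ c g ⟩
      g ⊕ x ≈⟨ ⊕-cong ≈-refl e ⟩
      g ⊕ y ∎
      where open ≈-Reasoning

    central-× : ∀ k {x} → Central x → Central (k × x)
    central-× zero    c g = ≡⇒≈ (trans (identˡ g) (sym (identʳ g)))
    central-× (suc k) {x} c g = begin
      x ⊕ k × x ⊕ g   ≡⟨ assoc x _ g ⟩
      x ⊕ (k × x ⊕ g) ≈⟨ ⊕-cong ≈-refl (central-× k c g) ⟩
      x ⊕ (g ⊕ k × x) ≡⟨ assoc x g _ ⟨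
      x ⊕ g ⊕ k × x   ≈⟨ ⊕-cong (c g) ≈-refl ⟩
      g ⊕ x ⊕ k × x   ≡⟨ assoc g x _ ⟩
      g ⊕ (x ⊕ k × x) ∎
      where open ≈-Reasoning

    ×-distrib-central : ∀ k {x c} → Central c → k × (x ⊕ c) ≈ k × x ⊕ k × c
    ×-distrib-central zero cc = ≡⇒≈ (sym (identˡ 𝟘))
    ×-distrib-central (suc k) {x} {c} cc = begin
      x ⊕ c ⊕ k × (x ⊕ c)         ≈⟨ ⊕-cong ≈-refl (×-distrib-central k cc) ⟩
      x ⊕ c ⊕ (k × x ⊕ k × c)     ≡⟨ assoc x c _ ⟩
      x ⊕ (c ⊕ (k × x ⊕ k × c))   ≡⟨ cong (x ⊕_) (assoc c _ _) ⟨
      x ⊕ (c ⊕ k × x ⊕ k × c)     ≈⟨ ⊕-cong ≈-refl (⊕-cong (cc (k × x)) ≈-refl) ⟩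
      x ⊕ (k × x ⊕ c ⊕ k × c)     ≡⟨ cong (x ⊕_) (assoc (k × x) c _) ⟩
      x ⊕ (k × x ⊕ (c ⊕ k × c))   ≡⟨ assoc x _ _ ⟨
      x ⊕ k × x ⊕ (c ⊕ k × c) ∎
      where open ≈-Reasoning

  ×-conj : ∀ k g x → k × (⊖ g ⊕ x ⊕ g) ≡ ⊖ g ⊕ k × x ⊕ g
  ×-conj zero g x = sym (trans (cong (_⊕ g) (identʳ (⊖ g))) (inverseˡ g))
  ×-conj (suc k) g x = begin
    ⊖ g ⊕ x ⊕ g ⊕ k × (⊖ g ⊕ x ⊕ g)   ≡⟨ cong (⊖ g ⊕ x ⊕ g ⊕_) (trans (×-conj k g x) (assoc (⊖ g) _ g)) ⟩
    ⊖ g ⊕ x ⊕ g ⊕ (⊖ g ⊕ (k × x ⊕ g)) ≡⟨ assoc (⊖ g ⊕ x) g _ ⟩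
    ⊖ g ⊕ x ⊕ (g ⊕ (⊖ g ⊕ (k × x ⊕ g))) ≡⟨ cong (⊖ g ⊕ x ⊕_) (\\-leftDividesˡ g _) ⟩
    ⊖ g ⊕ x ⊕ (k × x ⊕ g)              ≡⟨ assoc (⊖ g ⊕ x) _ g ⟨
    ⊖ g ⊕ x ⊕ k × x ⊕ g                ≡⟨ cong (_⊕ g) (assoc (⊖ g) x _) ⟩
    ⊖ g ⊕ (x ⊕ k × x) ⊕ g ∎
    where open ≡-Reasoning

  -- z generates a subgroup of order r of the centre of G / K.
  record Extension (K : NormalSubgroup) (r : ℕ) : Set where
    open NormalSubgroup K
    open Mod K
    field
      r-prime : Prime r
      z       : Fin n
      z∉      : z ∉ set
      rz∈     : r × z ∈ set
      central : Central z

  module Extend {K : NormalSubgroup} {r : ℕ} (E : Extension K r) where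
    open NormalSubgroup K
    open Mod K
    open Extension E

    private instance
      r≢0 : NonZero r
      r≢0 = prime⇒nonZero r-prime

    -- The bound `k` varies so that the order of K′ = `part r` can be computed by induction, one
    -- K-coset at a time.
    part : ℕ → DSet n
    mem (part k) g = Σ (Fin k) λ i → toℕ i × z ≈ g
    mem? (part k) g = Fin.any? λ i → toℕ i × z ≈? g

    set′ : DSet n
    set′ = part r

    multiple : ∀ i {g} → i × z ≈ g → g ∈ set′
    multiple i {g} e = fromℕ< (m%n<n i r) , (begin
        toℕ (fromℕ< (m%n<n i r)) × z         ≡⟨ cong (_× z) (Fin.toℕ-fromℕ< (m%n<n i r)) ⟩
        (i % r) × z                         ≡⟨ identʳ _ ⟨
        (i % r) × z ⊕ 𝟘                     ≈⟨ ⊕-cong ≈-refl (∈⇒≈0 (×-∈ (i / r) rz∈)) ⟩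
        (i % r) × z ⊕ (i / r) × (r × z)     ≡⟨ cong ((i % r) × z ⊕_) (×-assocˡ z (i / r) r) ⟩
        (i % r) × z ⊕ (i / r * r) × z       ≡⟨ ×-homo-+ z (i % r) (i / r * r) ⟨
        (i % r + i / r * r) × z             ≡⟨ cong (_× z) (m≡m%n+[m/n]*n i r) ⟨
        i × z                               ≈⟨ e ⟩
        g ∎)
      where open ≈-Reasoning

    central′ : ∀ {x} → x ∈ set′ → Central x
    central′ (i , e) = central-resp e (central-× (toℕ i) central)

    annihilates : ∀ {x} → x ∈ set′ → r × x ∈ set
    annihilates {x} (i , e) = ≈0⇒∈ (begin
        𝟘                   ≈⟨ ∈⇒≈0 (×-∈ (toℕ i) rz∈) ⟩
        toℕ i × (r × z)     ≡⟨ ×-assocˡ z (toℕ i) r ⟩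
        (toℕ i * r) × z     ≡⟨ cong (_× z) (*-comm (toℕ i) r) ⟩
        (r * toℕ i) × z     ≡⟨ ×-assocˡ z r (toℕ i) ⟨
        r × (toℕ i × z)     ≈⟨ ×-congʳ r e ⟩
        r × x ∎)
      where open ≈-Reasoning

    -- Multiples have natural coefficients, so the inverse modulo K is taken as a multiple.
    negate : ∀ {x} → x ∈ set′ → (r ∸ 1) × x ≈ ⊖ x
    negate {x} x∈ = ≈-cancelˡ x (begin
        x ⊕ (r ∸ 1) × x      ≡⟨⟩
        suc (r ∸ 1) × x      ≡⟨ cong (_× x) (suc-pred r) ⟩
        r × x                ≈⟨ ∈⇒≈0 (annihilates x∈) ⟨
        𝟘                    ≡⟨ inverseʳ x ⟨
        x ⊕ ⊖ x ∎)
      where open ≈-Reasoning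

    K′ : NormalSubgroup
    K′ = record
      { set = set′
      ; 0∈ = multiple 0 ≈-refl
      ; ⊕∈ = λ { {x} {y} (i , e) (j , f) →
          multiple (toℕ i + toℕ j) (≈-trans (≡⇒≈ (×-homo-+ z (toℕ i) (toℕ j))) (⊕-cong e f)) }
      ; ⊖∈ = λ { {x} x∈@(i , e) →
          multiple ((r ∸ 1) * toℕ i) (≈-trans (≡⇒≈ (sym (×-assocˡ z (r ∸ 1) (toℕ i))))
                                     (≈-trans (×-congʳ (r ∸ 1) e) (negate x∈))) }
      ; conj∈ = λ { g {x} x∈@(i , e) → multiple (toℕ i) (≈-trans e
          (≈-trans (≡⇒≈ (sym (//-rightDividesʳ g x))) (⊕-cong (central′ x∈ g) ≈-refl))) }
      }

    K⊆K′ : set ⊆ set′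
    K⊆K′ x∈ = multiple 0 (∈⇒≈0 x∈)

    z∈K′ : z ∈ set′
    z∈K′ = multiple 1 (≡⇒≈ (identʳ z))

    ≈⇒≈′ : ∀ {x y} → x ≈ y → Mod._≈_ K′ x y
    ≈⇒≈′ = K⊆K′

    ×z-injective : ∀ {i j} → i < j → j < r → ¬ (i × z ≈ j × z)
    ×z-injective {i} {j} i<j j<r e =
      z∉ (coprime-annihilates (prime⇒coprime r-prime (≤-<-trans (m∸n≤m j i) j<r)) rz∈ d∈)
      where
      instance
        _ : NonZero (j ∸ i)
        _ = >-nonZero (m<n⇒0<n∸m i<j)
      open ≈-Reasoning
      d∈ : (j ∸ i) × z ∈ set
      d∈ = ≈0⇒∈ (≈-cancelˡ (i × z) (begin
        i × z ⊕ 𝟘              ≡⟨ identʳ _ ⟩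
        i × z                  ≈⟨ e ⟩
        j × z                  ≡⟨ cong (_× z) (m+[n∸m]≡n (<⇒≤ i<j)) ⟨
        (i + (j ∸ i)) × z      ≡⟨ ×-homo-+ z i (j ∸ i) ⟩
        i × z ⊕ (j ∸ i) × z ∎))

    count-part : ∀ k → k ≤ r → count (part k) ≡ k * order
    count-part zero _ = count≡0 (part 0) λ { _ (() , _) }
    count-part (suc k) k<r = begin
      count (part (suc k))              ≡⟨ count-⊎ (part (suc k)) (coset (k × z)) (part k) split here′ weaken disj ⟩
      count (coset (k × z)) + count (part k) ≡⟨ cong₂ _+_ (count-coset (k × z)) (count-part k (<⇒≤ k<r)) ⟩
      order + k * order ∎
      where
      open ≡-Reasoning
      here′ : coset (k × z) ⊆ part (suc k)
      here′ e = fromℕ k , ≈-trans (≡⇒≈ (cong (_× z) (Fin.toℕ-fromℕ k))) e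
      weaken : part k ⊆ part (suc k)
      weaken (i , e) = inject₁ i , ≈-trans (≡⇒≈ (cong (_× z) (Fin.toℕ-inject₁ i))) e
      split : ∀ {x} → x ∈ part (suc k) → x ∈ coset (k × z) ⊎ x ∈ part k
      split (i , e) with toℕ i ≟ k
      ... | yes i≡k = inj₁ (subst (λ j → j × z ≈ _) i≡k e)
      ... | no i≢k = inj₂ (fromℕ< i<k , ≈-trans (≡⇒≈ (cong (_× z) (Fin.toℕ-fromℕ< i<k))) e)
        where i<k = ≤∧≢⇒< (s≤s⁻¹ (Fin.toℕ<n i)) i≢k
      disj : ∀ {x} → x ∈ coset (k × z) → x ∉ part k
      disj e (i , f) = ×z-injective (Fin.toℕ<n i) k<r (≈-trans f (≈-sym e))

    order′ : count set′ ≡ r * order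
    order′ = count-part r ≤-refl

    -- K′ / K has prime order: if d is i × z modulo K with 0 < i < r, then Bézout inverts i modulo r
    -- and recovers z from d.
    generates : ∀ {d h} → d ∈ set′ → d ∉ set → h ∈ set′ → ∃ λ k → k × d ≈ h
    generates {d} {h} (i , e) d∉ (j , f) = let (k , g) = z-multiple in
        toℕ j * k , (begin
        (toℕ j * k) × d     ≡⟨ ×-assocˡ d (toℕ j) k ⟨
        toℕ j × (k × d)     ≈⟨ ×-congʳ (toℕ j) g ⟩
        toℕ j × z           ≈⟨ f ⟩
        h ∎)
      where
      open ≈-Reasoning
      instance
        i≢0 : NonZero (toℕ i)
        i≢0 = ≢-nonZero λ i≡0 → d∉ (≈0⇒∈ (subst (λ t → t × z ≈ d) i≡0 e))
      z-multiple : ∃ λ k → k × d ≈ z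
      z-multiple with coprime-Bézout (prime⇒coprime r-prime (Fin.toℕ<n i))
      ... | Bézout.-+ a b eq = b , (begin
        b × d               ≈⟨ ×-congʳ b e ⟨
        b × (toℕ i × z)     ≡⟨ ×-assocˡ z b (toℕ i) ⟩
        (b * toℕ i) × z     ≡⟨ cong (_× z) eq ⟨
        z ⊕ (a * r) × z     ≡⟨ cong (z ⊕_) (×-assocˡ z a r) ⟨
        z ⊕ a × (r × z)     ≈⟨ ⊕-cong ≈-refl (∈⇒≈0 (×-∈ a rz∈)) ⟨
        z ⊕ 𝟘               ≡⟨ identʳ z ⟩
        z ∎)
      -- In this orientation 1 + b i = a r, so b × d is the inverse of z, and the factor r - 1
      -- corrects the sign.
      ... | Bézout.+- a b eq = (r ∸ 1) * b , (begin
        ((r ∸ 1) * b) × d   ≡⟨ ×-assocˡ d (r ∸ 1) b ⟨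
        (r ∸ 1) × (b × d)   ≈⟨ ×-congʳ (r ∸ 1) bd ⟩
        (r ∸ 1) × (⊖ z)     ≈⟨ negate (NormalSubgroup.⊖∈ K′ z∈K′) ⟩
        ⊖ ⊖ z               ≡⟨ ⁻¹-involutive z ⟩
        z ∎)
        where
        bd : b × d ≈ ⊖ z
        bd = ≈-cancelˡ z (begin
          z ⊕ b × d             ≈⟨ ⊕-cong ≈-refl (×-congʳ b e) ⟨
          z ⊕ b × (toℕ i × z)   ≡⟨ cong (z ⊕_) (×-assocˡ z b (toℕ i)) ⟩
          (1 + b * toℕ i) × z   ≡⟨ cong (_× z) eq ⟩
          (a * r) × z           ≡⟨ ×-assocˡ z a r ⟨
          a × (r × z)           ≈⟨ ∈⇒≈0 (×-∈ a rz∈) ⟨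
          𝟘                     ≡⟨ inverseʳ z ⟨
          z ⊕ ⊖ z ∎)

-- Primes and divisors

prime-coprime : ∀ {p q} → Prime p → Prime q → p ≢ q → Coprime p q
prime-coprime pp pq p≢q (d∣p , d∣q) with prime⇒irreducible pp d∣p | prime⇒irreducible pq d∣q
... | inj₁ d≡1 | _ = d≡1
... | inj₂ _ | inj₁ d≡1 = d≡1
... | inj₂ refl | inj₂ refl = contradiction refl p≢q

m<k*m : ∀ {m k} → 0 < m → 1 < k → m < k * m
m<k*m {m} {k} m>0 k>1 = subst (m <_) (*-comm m k) (m<m*n m k ⦃ >-nonZero m>0 ⦄ k>1)

composite-factors : ∀ {N} → Composite N → Σ ℕ λ a → Σ ℕ λ b → 1 < a ⊗ 1 < b ⊗ N ≡ a * b
composite-factors {N} (composite {d} d<N d∣N@(divides q eq)) =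
  q , d , quotient>1 d∣N d<N , nonTrivial⇒n>1 d , eq

prime-factor : ∀ N → 1 < N → Σ ℕ λ q → Prime q ⊗ q ∣ N
prime-factor = <-rec _ go
  where
  go : ∀ N → (∀ {M} → M < N → 1 < M → Σ ℕ λ q → Prime q ⊗ q ∣ M) → 1 < N → Σ ℕ λ q → Prime q ⊗ q ∣ N
  go (suc zero) _ (s≤s ())
  go N@(suc (suc _)) rec 1<N with prime? N
  ... | yes pN = N , pN , ∣-refl
  ... | no ¬pN =
    let (a , b , 1<a , 1<b , eq) = composite-factors (¬prime⇒composite ¬pN)
        a<N = subst (a <_) (sym eq) (m<m*n a b ⦃ >-nonZero (<-trans (s≤s z≤n) 1<a) ⦄ 1<b)
        (q , pq , q∣a) = rec a<N 1<a
    in q , pq , ∣-trans q∣a (subst (a ∣_) (sym eq) (m∣m*n b))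

-- Central series of nilpotent groups

module NilpotentGroups {n : ℕ} (G : FiniteGroup n) where
  open FiniteGroup G
  open GroupTheory G

  module _ (K : NormalSubgroup) where
    open NormalSubgroup K
    open Mod K

    coset-representatives : (P : DSet n) → (∀ {x y} → x ≈ y → x ∈ P → y ∈ P) →
      Σ (List (Fin n)) λ ws → All (_∈ P) ws ⊗ (∀ {g} → g ∈ P → Any (_≈ g) ws) ⊗ count P ≡ length ws * order
    coset-representatives P resp = go (count P) P resp ≤-refl
      where
      go : ∀ k (P : DSet n) → (∀ {x y} → x ≈ y → x ∈ P → y ∈ P) → count P ≤ k →
           Σ (List (Fin n)) λ ws → All (_∈ P) ws ⊗ (∀ {g} → g ∈ P → Any (_≈ g) ws) ⊗ count P ≡ length ws * order
      go zero P resp le = [] , [] , (λ g∈ → contradiction le (<⇒≱ (count>0 P g∈))) , n≤0⇒n≡0 le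
      go (suc k) P resp le with 0 <? count P
      ... | no ≯0 = [] , [] , (λ g∈ → contradiction (count>0 P g∈) ≯0) , n≤0⇒n≡0 (≮⇒≥ ≯0)
      ... | yes >0 =
        let (w , w∈) = count>0⁻ P >0
            P′ = P ∖ coset w
            resp′ : ∀ {x y} → x ≈ y → x ∈ P′ → y ∈ P′
            resp′ e (x∈ , x∉) = resp e x∈ , λ f → x∉ (≈-trans f (≈-sym e))
            smaller = count-< P′ P proj₁ w∈ (λ (_ , w∉) → w∉ ≈-refl)
            (ws , ws∈ , cover , size) = go k P′ resp′ (s≤s⁻¹ (≤-trans smaller le))
            cover′ : ∀ {g} → g ∈ P → Any (_≈ g) (w ∷ ws)
            cover′ {g} g∈ = case w ≈? g of λ where
              (yes e) → here e
              (no ne) → there (cover (g∈ , ne))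
            open ≡-Reasoning
        in w ∷ ws , w∈ ∷ All.map proj₁ ws∈ , cover′ , (begin
          count P                               ≡⟨ count-∖ P (coset w) ⟩
          count (P ∩ coset w) + count P′        ≡⟨ cong (_+ count P′) (count-cong (P ∩ coset w) (coset w) proj₂ (λ e → resp e w∈ , e)) ⟩
          count (coset w) + count P′            ≡⟨ cong₂ _+_ (count-coset w) size ⟩
          order + length ws * order ∎)

    lagrange : order ∣ n
    lagrange = let (ws , _ , _ , size) = coset-representatives (full n) (λ _ _ → tt) in
      divides (length ws) (trans (sym (count-full n)) size)

    order>0 : 0 < order
    order>0 = count>0 set 0∈

    -- If every element central modulo K were in K, the lower central series would lie in K from its trivial term up.
    central-outside : Nilpotent G → order < n → ∃ λ z → z ∉ set ⊗ Central z
    central-outside (c , γc) lt with Fin.any? (λ z → ¬? (mem? set z) ×-dec Fin.all? (λ g → z ⊕ g ≈? g ⊕ z))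
    ... | yes found = found
    ... | no none = contradiction lt (≤⇒≯ (subst (_≤ order) (count-full n) (count-mono (full n) set λ _ → climb c (λ x xγ → subst (_∈ set) (sym (γc x xγ)) 0∈) _ tt)))
      where
      closed : ∀ x → Central x → x ∈ set
      closed x cx with mem? set x
      ... | yes x∈ = x∈
      ... | no x∉ = contradiction (x , x∉ , cx) none
      climb : ∀ i → (∀ x → γ G i x → x ∈ set) → ∀ x → γ G 0 x → x ∈ set
      climb zero h = h
      climb (suc i) h = climb i λ x xγ → closed x λ g → ≈-sym (subst (_∈ set) (comm≡ x g) (h _ (gen (x , g , xγ , refl))))
        where
        comm≡ : ∀ x g → comm G x g ≡ ⊖ (g ⊕ x) ⊕ (x ⊕ g)
        comm≡ x g = trans (assoc _ x g) (cong (_⊕ (x ⊕ g)) (sym (⁻¹-anti-homo-∙ g x)))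

    -- Strong induction on N. If N = a b is composite, either b × z lies in K and N drops to b, or b
    -- × z takes the place of z and N drops to a.
    prime-multiple : ∀ N → 0 < N → ∀ z → z ∉ set → Central z → N × z ∈ set → ∃ (Extension K)
    prime-multiple = <-rec _ go
      where
      go : ∀ N → (∀ {M} → M < N → 0 < M → ∀ z → z ∉ set → Central z → M × z ∈ set → ∃ (Extension K)) →
           0 < N → ∀ z → z ∉ set → Central z → N × z ∈ set → ∃ (Extension K)
      go 1 rec _ z z∉ cz Nz = contradiction (subst (_∈ set) (identʳ z) Nz) z∉
      go N@(suc (suc _)) rec _ z z∉ cz Nz with prime? N
      ... | yes pN = N , record { r-prime = pN ; z = z ; z∉ = z∉ ; rz∈ = Nz ; central = cz }
      ... | no ¬pN with composite-factors (¬prime⇒composite ¬pN)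
      ... | a , b , 1<a , 1<b , N≡ab with mem? set (b × z)
      ... | yes bz∈ = rec (subst (b <_) (sym N≡ab) (m<k*m (<-trans (s≤s z≤n) 1<b) 1<a))
                          (<-trans (s≤s z≤n) 1<b) z z∉ cz bz∈
      ... | no bz∉ = rec (subst (a <_) (sym N≡ab) (m<m*n a b ⦃ >-nonZero (<-trans (s≤s z≤n) 1<a) ⦄ 1<b))
                         (<-trans (s≤s z≤n) 1<a) (b × z) bz∉ (central-× b cz)
                         (subst (_∈ set) (trans (cong (_× z) N≡ab) (sym (×-assocˡ z a b))) Nz)

  torsion : ∀ z → ∃ λ N → 0 < N ⊗ N × z ≡ 𝟘
  torsion z with Fin.pigeonhole (n<1+n n) (λ (i : Fin (suc n)) → toℕ i × z)
  ... | i , j , i<j , eq = toℕ j ∸ toℕ i , m<n⇒0<n∸m i<j , ⊕-cancelˡ (toℕ i × z) _ _ (begin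
      toℕ i × z ⊕ (toℕ j ∸ toℕ i) × z  ≡⟨ ×-homo-+ z (toℕ i) (toℕ j ∸ toℕ i) ⟨
      (toℕ i + (toℕ j ∸ toℕ i)) × z    ≡⟨ cong (_× z) (m+[n∸m]≡n (<⇒≤ i<j)) ⟩
      toℕ j × z                        ≡⟨ eq ⟨
      toℕ i × z                        ≡⟨ identʳ _ ⟨
      toℕ i × z ⊕ 𝟘 ∎)
    where open ≡-Reasoning

  n>0 : 0 < n
  n>0 = ≤-<-trans z≤n (Fin.toℕ<n 𝟘)

  -- The primes of a central series can be met in any order: an element of order q modulo a larger term K′ is
  -- multiplied by the index of K in K′.
  extension : Nilpotent G → ∀ K q → Prime q → q * NormalSubgroup.order K ∣ n → Extension K q
  extension nil K q pq = go (n ∸ NormalSubgroup.order K) K ≤-refl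
    where
    go : ∀ k K → n ∸ NormalSubgroup.order K ≤ k → q * NormalSubgroup.order K ∣ n → Extension K q
    go k K le div with central-outside K nil lt
      where
      open NormalSubgroup K
      lt : order < n
      lt = <-≤-trans (m<k*m (order>0 K) (nonTrivial⇒n>1 q ⦃ prime⇒nonTrivial pq ⦄))
                     (∣⇒≤ ⦃ >-nonZero n>0 ⦄ div)
    ... | z , z∉ , cz with torsion z
    ... | N , N>0 , Nz≡0 with prime-multiple K N N>0 z z∉ cz (subst (_∈ NormalSubgroup.set K) (sym Nz≡0) (NormalSubgroup.0∈ K))
    ... | r , E with r ≟ q
    ... | yes refl = E
    ... | no r≢q with k | le
    ... | zero | le = contradiction (subst (_≤ n) (Extend.order′ E) (∣⇒≤ ⦃ >-nonZero n>0 ⦄ (lagrange (Extend.K′ E))))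
                        (<⇒≱ (≤-<-trans (m∸n≡0⇒m≤n (n≤0⇒n≡0 le)) bigger))
      where
      bigger : NormalSubgroup.order K < r * NormalSubgroup.order K
      bigger = m<k*m (order>0 K) (nonTrivial⇒n>1 r ⦃ prime⇒nonTrivial (Extension.r-prime E) ⦄)
    ... | suc k | le = record
      { r-prime = pq
      -- `z′` has order q modulo K′, and r annihilates K′ / K. Hence q × (r × z′) lies in K, while r
      -- × z′ does not, because r and q are coprime.
      ; z = r × z′
      ; z∉ = λ rz′∈ → E′.z∉ (Mod.coprime-annihilates K′ (prime-coprime E.r-prime pq r≢q) (X.K⊆K′ rz′∈) E′.rz∈)
      ; rz∈ = subst (_∈ set) (trans (×-assocˡ z′ r q) (trans (cong (_× z′) (*-comm r q)) (sym (×-assocˡ z′ q r))))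
                (X.annihilates E′.rz∈)
      -- Conjugation by g turns `z′` into z′ ⊕ c g with `c g` in K′, which is central modulo K. The
      -- multiple by r distributes over this sum, and r × c g vanishes modulo K.
      ; central = λ g → ⊕-cancel (≈-trans (≡⇒≈ (sym (×-conj r g z′))) (≈-trans (×-congʳ r (≡⇒≈ (conj≡ g)))
           (≈-trans (×-distrib-central r (X.central′ (c∈ g)))
             (≈-trans (⊕-cong ≈-refl (≈-sym (∈⇒≈0 (X.annihilates (c∈ g))))) (≡⇒≈ (identʳ _))))))
      }
      where
      open NormalSubgroup K
      open Mod K
      module E = Extension E
      module X = Extend E
      K′ = X.K′
      bigger : order < r * order
      bigger = m<k*m (order>0 K) (nonTrivial⇒n>1 r ⦃ prime⇒nonTrivial E.r-prime ⦄)
      order′∣n : r * order ∣ n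
      order′∣n = subst (_∣ n) X.order′ (lagrange K′)
      qr∣n : q * NormalSubgroup.order K′ ∣ n
      qr∣n = subst (λ t → q * t ∣ n) (sym X.order′) (helper div order′∣n)
        where
        helper : q * order ∣ n → r * order ∣ n → q * (r * order) ∣ n
        helper (divides u eq) (divides v eq′) = divides w (trans eq′ (trans (cong (_* (r * order)) v≡) (*-assoc w q (r * order))))
          where
          cancelled : v * r ≡ u * q
          cancelled = *-cancelʳ-≡ _ _ order ⦃ >-nonZero (order>0 K) ⦄
            (trans (*-assoc v r order) (trans (sym eq′) (trans eq (sym (*-assoc u q order)))))
          q∣v : q ∣ v
          q∣v = coprime-divisor {n = r} (prime-coprime pq E.r-prime (r≢q ∘ sym)) (divides u (trans (*-comm r v) cancelled))
          w = _∣_.quotient q∣v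
          v≡ : v ≡ w * q
          v≡ = _∣_.equality q∣v
      decrease : n ∸ NormalSubgroup.order K′ < n ∸ order
      decrease = ∸-monoʳ-< (subst (order <_) (sym X.order′) bigger) (∣⇒≤ ⦃ >-nonZero n>0 ⦄ (lagrange K′))
      E′ : Extension K′ q
      E′ = go k K′ (s≤s⁻¹ (≤-trans decrease le)) qr∣n
      module E′ = Extension E′
      z′ = E′.z
      c : Fin n → Fin n
      c g = ⊖ z′ ⊕ (⊖ g ⊕ z′ ⊕ g)
      conj≡ : ∀ g → ⊖ g ⊕ z′ ⊕ g ≡ z′ ⊕ c g
      conj≡ g = sym (\\-leftDividesˡ z′ _)
      c∈ : ∀ g → c g ∈ X.set′
      c∈ g = Mod.≈-trans K′ (Mod.≡⇒≈ K′ (sym (\\-leftDividesʳ g z′))) (Mod.≈-trans K′ (Mod.⊕-cong K′ {⊖ g} (Mod.≈-refl K′) (Mod.≈-sym K′ (E′.central g))) (Mod.≡⇒≈ K′ (sym (assoc (⊖ g) z′ g))))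
      ⊕-cancel : ∀ {x g} → ⊖ g ⊕ x ⊕ g ≈ x → x ⊕ g ≈ g ⊕ x
      ⊕-cancel {x} {g} e = ≈-trans (≡⇒≈ (sym (trans (cong (g ⊕_) (assoc (⊖ g) x g)) (\\-leftDividesˡ g _)))) (⊕-cong (≈-refl {g}) e)

-- The Cauchy-Davenport theorem in K′ / K

module CauchyDavenport {n : ℕ} (G : FiniteGroup n) where
  open FiniteGroup G
  open GroupTheory G

  module _ {K : NormalSubgroup} {r : ℕ} (E : Extension K r) where
    open NormalSubgroup K
    open Mod K
    open Extend E
    open NormalSubgroup K′ using () renaming (⊕∈ to ⊕∈′; ⊖∈ to ⊖∈′)

    Saturated : (Fin n → Set) → Set
    Saturated P = ∀ {x y} → x ≈ y → P x → P y

    set′-saturated : Saturated (_∈ set′)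
    set′-saturated {x} {y} e x∈ = subst (_∈ set′) (\\-leftDividesˡ x y) (⊕∈′ x∈ (K⊆K′ e))

    -- A nonempty union of K-cosets closed under adding d is all of K′, because d generates K′ / K.
    -- This is where the prime index enters Cauchy-Davenport.
    escape : ∀ {X d x₀} → Saturated (_∈ X) → X ⊆ set′ → x₀ ∈ X → d ∈ set′ → d ∉ set →
             (∃ λ x → x ∈ X ⊗ x ⊕ d ∉ X) ⊎ set′ ⊆ X
    escape {X} {d} {x₀} sat X⊆ x₀∈ d∈ d∉ with Fin.any? (λ x → mem? X x ×-dec ¬? (mem? X (x ⊕ d)))
    ... | yes found = inj₁ found
    ... | no none = inj₂ λ {h} h∈ → let (k , e) = generates d∈ d∉ (⊕∈′ (⊖∈′ (X⊆ x₀∈)) h∈) in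
        sat (≈-trans (⊕-cong (≈-refl {x₀}) e) (≡⇒≈ (\\-leftDividesˡ x₀ h))) (multiples k x₀∈)
      where
      shift : ∀ {x} → x ∈ X → x ⊕ d ∈ X
      shift {x} x∈ with mem? X (x ⊕ d)
      ... | yes p = p
      ... | no np = contradiction (x , x∈ , np) none
      multiples : ∀ k {x} → x ∈ X → x ⊕ k × d ∈ X
      multiples zero {x} x∈ = subst (_∈ X) (sym (identʳ x)) x∈
      multiples (suc k) {x} x∈ = subst (_∈ X) (assoc x d _) (multiples k (shift x∈))

    -- Cauchy–Davenport in the group K′ / K of prime order, by Davenport's transform.
    cauchy-davenport : ∀ k (X Y : DSet n) {x₀ y₀} (P : Fin n → Set) → count Y ≤ k →
      X ⊆ set′ → Saturated (_∈ X) → x₀ ∈ X → Y ⊆ set′ → Saturated (_∈ Y) → y₀ ∈ Y →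
      Saturated P → (∀ {x y} → x ∈ X → y ∈ Y → P (x ⊕ y)) →
      Σ (DSet n) λ Z → Z ⊆ set′ ⊗ Saturated (_∈ Z) ⊗ (∀ {z} → z ∈ Z → P z) ⊗
        (count X + count Y ≤ count Z + order ⊎ count set′ ≤ count Z)
    cauchy-davenport zero X Y P le X⊆ Xsat x₀∈ Y⊆ Ysat y₀∈ Psat XY = contradiction le (<⇒≱ (count>0 Y y₀∈))
    cauchy-davenport (suc k) X Y {x₀} {y₀} P le X⊆ Xsat x₀∈ Y⊆ Ysat y₀∈ Psat XY
      with Fin.any? (λ y → mem? Y y ×-dec ¬? (y₀ ≈? y))
    ... | no none = Z , Z⊆ , (λ e → Xsat (⊕-cong e ≈-refl)) , Z→P , inj₁ (+-mono-≤ X≤Z Y≤)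
      where
      Z : DSet n
      mem Z g = g ⊕ ⊖ y₀ ∈ X
      mem? Z g = mem? X (g ⊕ ⊖ y₀)
      Z⊆ : Z ⊆ set′
      Z⊆ {g} g∈ = subst (_∈ set′) (//-rightDividesˡ y₀ g) (⊕∈′ (X⊆ g∈) (Y⊆ y₀∈))
      Z→P : ∀ {g} → g ∈ Z → P g
      Z→P {g} g∈ = subst P (//-rightDividesˡ y₀ g) (XY g∈ y₀∈)
      X≤Z : count X ≤ count Z
      X≤Z = count-image X Z (_⊕ y₀) (⊕-cancelʳ y₀ _ _) (subst (_∈ X) (sym (//-rightDividesʳ y₀ _)))
      Y≤ : count Y ≤ order
      Y≤ = subst (count Y ≤_) (count-coset y₀) (count-mono Y (coset y₀) inside)
        where
        inside : Y ⊆ coset y₀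
        inside {y} y∈ with y₀ ≈? y
        ... | yes e = e
        ... | no ne = contradiction (y , y∈ , ne) none
    ... | yes (y₁ , y₁∈ , y₀≉y₁) with escape {X = X} Xsat X⊆ x₀∈ (⊕∈′ (⊖∈′ (Y⊆ y₀∈)) (Y⊆ y₁∈)) y₀≉y₁
    ... | inj₂ all = set′ , id , set′-saturated , Z→P , inj₂ ≤-refl
      where
      Z→P : ∀ {g} → g ∈ set′ → P g
      Z→P {g} g∈ = subst P (//-rightDividesˡ y₀ g) (XY (all (⊕∈′ g∈ (⊖∈′ (Y⊆ y₀∈)))) y₀∈)
    ... | inj₁ (x , x∈ , x⊕d∉) =
      let (Z , Z⊆ , Zsat , Z→P , size) = cauchy-davenport k X⁺ Y⁻ P (s≤s⁻¹ (≤-trans smaller le))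
            X⁺⊆ X⁺sat (inj₁ x₀∈) (Y⊆ ∘ proj₁) Y⁻sat y₀∈⁻ Psat XY′
      in Z , Z⊆ , Zsat , Z→P , Sum.map₁ (≤-trans sizes) size
      where
      -- Translation by `e` sends y₀ to x in X and y₁ to x ⊕ d outside X. So y₀ stays in `Y⁻`, y₁
      -- leaves it, and the induction on the size of Y proceeds.
      e = x ⊕ ⊖ y₀
      e∈ : e ∈ set′
      e∈ = ⊕∈′ (X⊆ x∈) (⊖∈′ (Y⊆ y₀∈))
      shifted : DSet n
      mem shifted y = e ⊕ y ∈ X
      mem? shifted y = mem? X (e ⊕ y)
      X⁺ Y⁻ : DSet n
      mem X⁺ g = g ∈ X ⊎ ⊖ e ⊕ g ∈ Y
      mem? X⁺ g = mem? X g ⊎-dec mem? Y (⊖ e ⊕ g)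
      Y⁻ = Y ∩ shifted
      X⁺⊆ : X⁺ ⊆ set′
      X⁺⊆ (inj₁ g∈) = X⊆ g∈
      X⁺⊆ {g} (inj₂ g∈) = subst (_∈ set′) (\\-leftDividesˡ e g) (⊕∈′ e∈ (Y⊆ g∈))
      X⁺sat : Saturated (_∈ X⁺)
      X⁺sat f (inj₁ g∈) = inj₁ (Xsat f g∈)
      X⁺sat f (inj₂ g∈) = inj₂ (Ysat (⊕-cong (≈-refl {⊖ e}) f) g∈)
      Y⁻sat : Saturated (_∈ Y⁻)
      Y⁻sat f (y∈ , ey∈) = Ysat f y∈ , Xsat (⊕-cong (≈-refl {e}) f) ey∈
      y₀∈⁻ : y₀ ∈ Y⁻
      y₀∈⁻ = y₀∈ , subst (_∈ X) (sym (//-rightDividesˡ y₀ x)) x∈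
      y₁∉⁻ : y₁ ∉ Y⁻
      y₁∉⁻ (_ , h) = x⊕d∉ (subst (_∈ X) (assoc x (⊖ y₀) y₁) h)
      smaller : count Y⁻ < count Y
      smaller = count-< Y⁻ Y proj₁ y₁∈ y₁∉⁻
      XY′ : ∀ {g y} → g ∈ X⁺ → y ∈ Y⁻ → P (g ⊕ y)
      XY′ (inj₁ g∈) (y∈ , _) = XY g∈ y∈
      -- Here g comes from the translate of Y and e ⊕ y lies in X, so the summands trade roles: g ⊕
      -- y is congruent to (e ⊕ y) ⊕ (⊖ e ⊕ g), as y is central modulo K.
      XY′ {g} {y} (inj₂ g∈) (y∈ , ey∈) = Psat (begin
          e ⊕ y ⊕ (⊖ e ⊕ g)       ≡⟨ assoc e y _ ⟩
          e ⊕ (y ⊕ (⊖ e ⊕ g))     ≈⟨ ⊕-cong (≈-refl {e}) (central′ (Y⊆ y∈) _) ⟩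
          e ⊕ (⊖ e ⊕ g ⊕ y)       ≡⟨ cong (e ⊕_) (assoc (⊖ e) g y) ⟩
          e ⊕ (⊖ e ⊕ (g ⊕ y))     ≡⟨ \\-leftDividesˡ e _ ⟩
          g ⊕ y ∎) (XY ey∈ g∈)
        where open ≈-Reasoning
      sizes : count X + count Y ≤ count X⁺ + count Y⁻
      sizes = begin
          count X + count Y                                ≡⟨ cong (count X +_) (count-∖ Y shifted) ⟩
          count X + (count Y⁻ + count (Y ∖ shifted))       ≤⟨ +-monoʳ-≤ (count X) (+-monoʳ-≤ (count Y⁻) moved) ⟩
          count X + (count Y⁻ + count (X⁺ ∖ X))            ≡⟨ rearrange (count X) (count Y⁻) (count (X⁺ ∖ X)) ⟩
          count X + count (X⁺ ∖ X) + count Y⁻              ≡⟨ cong (λ t → t + count (X⁺ ∖ X) + count Y⁻) (count-cong X (X⁺ ∩ X) (λ h → inj₁ h , h) proj₂) ⟩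
          count (X⁺ ∩ X) + count (X⁺ ∖ X) + count Y⁻       ≡⟨ cong (_+ count Y⁻) (count-∖ X⁺ X) ⟨
          count X⁺ + count Y⁻ ∎
        where
        open ≤-Reasoning
        rearrange : ∀ a b c → a + (b + c) ≡ a + c + b
        rearrange = solve-∀
        moved : count (Y ∖ shifted) ≤ count (X⁺ ∖ X)
        moved = count-image (Y ∖ shifted) (X⁺ ∖ X) (e ⊕_) (⊕-cancelˡ e _ _)
          λ { (y∈ , ey∉) → inj₂ (subst (_∈ Y) (sym (\\-leftDividesʳ e _)) y∈) , ey∉ }

    union : List (Fin n) → DSet n
    mem (union ds) g = Any (_≈ g) ds
    mem? (union ds) g = Any.any? (_≈? g) ds

    count-union : ∀ {ds} → AllPairs (λ x y → ¬ (x ≈ y)) ds → count (union ds) ≡ length ds * order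
    count-union [] = count≡0 (union []) λ _ ()
    count-union {d ∷ ds} (d≉ ∷ ps) = begin
        count (union (d ∷ ds))               ≡⟨ count-⊎ (union (d ∷ ds)) (coset d) (union ds)
                                                  (λ { (here e) → inj₁ e ; (there q) → inj₂ q }) here there
                                                  (λ e q → All.All¬⇒¬Any d≉ (Any.map (λ f → ≈-trans e (≈-sym f)) q)) ⟩
        count (coset d) + count (union ds)   ≡⟨ cong₂ _+_ (count-coset d) (count-union ps) ⟩
        order + length ds * order ∎
      where open ≡-Reasoning

  -- The elements of S ∖ T are those already used; e decides whether the empty sum may be used as well.
  module Sums (S : DSet n) where

    record Reach (e : Set) (T : DSet n) (y : Fin n) : Set where
      constructor reached
      field
        summands : List (Fin n)
        nonempty : summands ≡ [] → e
        unique   : Unique summands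
        used     : All (_∈ S ∖ T) summands
        sum≡     : sumL G summands ≡ y

    reach-mono : ∀ {e e′ T T′ y} → (e → e′) → T′ ⊆ T → Reach e T y → Reach e′ T′ y
    reach-mono f sub (reached xs ne u a s) = reached xs (f ∘ ne) u (All.map (λ (x∈ , x∉) → x∈ , x∉ ∘ sub) a) s

    sumL-++ : ∀ xs ys → sumL G (xs ++ ys) ≡ sumL G xs ⊕ sumL G ys
    sumL-++ [] ys = sym (identˡ _)
    sumL-++ (x ∷ xs) ys = trans (cong (x ⊕_) (sumL-++ xs ys)) (sym (assoc x _ _))

    reach-⊕ : ∀ {e T T′ x a} → a ∈ S → a ∈ T → a ∉ T′ → T′ ⊆ T → Reach e T x → Reach ⊥ T′ (x ⊕ a)
    reach-⊕ {a = a} a∈S a∈T a∉ sub (reached xs _ u all s) = reached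
      (xs ++ a ∷ []) (λ eq → case List.++-conicalʳ xs (a ∷ []) eq of λ ())
      (Unique.++⁺ u ([] ∷ []) (λ { (y∈ , here refl) → proj₂ (All.lookup all y∈) a∈T }))
      (All.++⁺ (All.map (λ (y∈ , y∉) → y∈ , y∉ ∘ sub) all) ((a∈S , a∉) ∷ []))
      (trans (sumL-++ xs (a ∷ [])) (cong₂ _⊕_ s (identʳ a)))

    module _ (K : NormalSubgroup) where
      open NormalSubgroup K
      open Mod K

      -- Filling whole K-cosets makes the notion invariant under congruence modulo K, so that inside
      -- K′ equations are needed only up to K.
      Full : Set → DSet n → Fin n → Set
      Full e T x = ∀ y → x ≈ y → Reach e T y

      full-resp : ∀ {e T x x′} → x ≈ x′ → Full e T x → Full e T x′
      full-resp p f y q = f y (≈-trans p q)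

      full-mono : ∀ {e e′ T T′ y} → (e → e′) → T′ ⊆ T → Full e T y → Full e′ T′ y
      full-mono g sub f y q = reach-mono g sub (f y q)

      full-⊕ : ∀ {e T T′ x a} → a ∈ S → a ∈ T → a ∉ T′ → T′ ⊆ T → Full e T x → Full ⊥ T′ (x ⊕ a)
      full-⊕ {T′ = T′} {x} {a} a∈S a∈T a∉ sub f y q = subst (Reach ⊥ T′) (//-rightDividesˡ a y)
        (reach-⊕ a∈S a∈T a∉ sub (f (y ⊕ ⊖ a) (≈-trans (≡⇒≈ (sym (//-rightDividesʳ a x))) (⊕-cong q ≈-refl))))

      Covered : Set → DSet n → Set
      Covered e T = ∃ (Full e T)

    -- Filling K′ from K by single elements and by slices

    module _ {K : NormalSubgroup} {r : ℕ} (E : Extension K r) where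
      open NormalSubgroup K
      open Mod K
      open Extend E
      open NormalSubgroup K′ using () renaming (0∈ to 0∈′)
      private
        module Mod′ = Mod K′

      -- `X` is a decidable part of the filled K-cosets, shifted by `c` into K′, so that it can be
      -- counted. It contains at least `b` of the r cosets; b = r means that a coset of K′ is
      -- filled.
      record Stage (e : Set) (T : DSet n) (b : ℕ) : Set₁ where
        field
          X         : DSet n
          X⊆        : X ⊆ set′
          saturated : Saturated E (_∈ X)
          c         : Fin n
          reach     : ∀ {d} → d ∈ X → Full K e T (d ⊕ c)
          size      : b * order ≤ count X

      open Stage

      stage-mono : ∀ {e e′ T T′ b} → (e → e′) → T′ ⊆ T → Stage e T b → Stage e′ T′ b
      stage-mono f sub st = record
        { X = X st ; X⊆ = X⊆ st ; saturated = saturated st ; c = c st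
        ; reach = full-mono K f sub ∘ reach st ; size = size st }

      start : ∀ {e T} → Covered K e T → Stage e T 1
      start (c , f) = record
        { X = set ; X⊆ = K⊆K′ ; saturated = λ p x∈ → subst (_∈ set) (\\-leftDividesˡ _ _) (⊕∈ x∈ p) ; c = c
        ; reach = λ d∈ → full-resp K (≈-trans (≡⇒≈ (sym (identˡ c))) (⊕-cong (∈⇒≈0 d∈) ≈-refl)) f
        ; size = ≤-reflexive (+-identityʳ order) }

      finish : ∀ {e T} → Stage e T r → Covered K′ e T
      finish st = c st , λ y q →
        reach st (count-⊆-≡ (X st) set′ (X⊆ st) (≤-trans (≤-reflexive order′) (size st)) q) y
          (≈-trans (central′ q (c st)) (≡⇒≈ (\\-leftDividesˡ (c st) y)))

      -- Cauchy-Davenport for X and the cosets of `ds`. The last hypothesis keeps the claimed size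
      -- within r cosets, so that the outcome in which all of K′ is filled also meets it.
      grow : ∀ {e e′ T T′ b} ds {c′} (st : Stage e T b) → 0 < b → 0 < length ds →
             AllPairs (λ x y → ¬ (x ≈ y)) ds → All (_∈ set′) ds →
             (∀ {d t} → d ∈ X st → t ∈ₗ ds → Full K e′ T′ (d ⊕ t ⊕ c′)) →
             b + length ds ≤ suc r → Stage e′ T′ (b + length ds ∸ 1)
      grow {e′ = e′} {T′ = T′} {b = b} ds@(t₀ ∷ _) {c′} st b>0 _ ≉ds ds⊆ f b≤r =
        let (x₀ , x₀∈) = count>0⁻ (X st) (<-≤-trans (<-≤-trans (order>0 K) (m≤n*m order b ⦃ >-nonZero b>0 ⦄)) (size st))
            (Z , Z⊆ , Zsat , Z→P , sizes) = cauchy-davenport E (count Y) (X st) Y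
              (λ y → Full K e′ T′ (y ⊕ c′)) ≤-refl (X⊆ st) (saturated st) x₀∈ Y⊆ Ysat (here ≈-refl)
              (λ p → full-resp K (⊕-cong p ≈-refl)) XY
        in record { X = Z ; X⊆ = Z⊆ ; saturated = Zsat ; c = c′ ; reach = Z→P ; size = bound Z sizes }
        where
        open NilpotentGroups G using (order>0)
        Y = union E ds
        Y⊆ : Y ⊆ set′
        Y⊆ y∈ = All.lookupWith (λ { {x} d∈ e → set′-saturated E e d∈ }) ds⊆ y∈
        Ysat : Saturated E (_∈ Y)
        Ysat p = Any.map (λ q → ≈-trans q p)
        XY : ∀ {x y} → x ∈ X st → y ∈ Y → Full K e′ T′ (x ⊕ y ⊕ c′)
        XY x∈ y∈ = let (t , t∈ , q) = find y∈ in
          full-resp K (⊕-cong (⊕-cong ≈-refl q) ≈-refl) (f x∈ t∈)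
        bound : ∀ Z → count (X st) + count Y ≤ count Z + order ⊎ count set′ ≤ count Z →
                (b + length ds ∸ 1) * order ≤ count Z
        bound Z (inj₁ h) = +-cancelʳ-≤ order _ _ (begin
            (b + length ds ∸ 1) * order + order   ≡⟨ +-comm _ order ⟩
            suc (b + length ds ∸ 1) * order       ≡⟨ cong (_* order) (m+[n∸m]≡n (≤-trans b>0 (m≤m+n b _))) ⟩
            (b + length ds) * order               ≡⟨ *-distribʳ-+ order b (length ds) ⟩
            b * order + length ds * order         ≡⟨ cong (b * order +_) (count-union E ≉ds) ⟨
            b * order + count Y                   ≤⟨ +-monoˡ-≤ _ (size st) ⟩
            count (X st) + count Y                ≤⟨ h ⟩
            count Z + order ∎)
          where open ≤-Reasoning
        bound Z (inj₂ h) = ≤-trans (*-monoˡ-≤ order (∸-monoˡ-≤ 1 b≤r)) (≤-trans (≤-reflexive (sym order′)) h)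

      -- The two choices are 𝟘 and a. Choosing 𝟘 adds no summand, which is why the flag `e` survives
      -- unchanged.
      add-single : ∀ {e T a b} → Stage e T b → 0 < b → b < r → a ∈ S → a ∈ T → a ∈ set′ → a ∉ set →
                   Stage e (T ∖ ⟪ a ∷ [] ⟫) (suc b)
      add-single {e} {T} {a} {b} st b>0 b<r a∈S a∈T a∈ a∉ =
        subst (Stage e (T ∖ ⟪ a ∷ [] ⟫)) (cong (_∸ 1) (+-comm b 2)) (grow (𝟘 ∷ a ∷ []) {c st} st b>0 (s≤s z≤n)
          (((λ p → a∉ (≈0⇒∈ p)) ∷ []) ∷ [] ∷ []) (0∈′ ∷ a∈ ∷ []) new (≤-trans (≤-reflexive (+-comm b 2)) (s≤s b<r)))
        where
        new : ∀ {d t} → d ∈ X st → t ∈ₗ 𝟘 ∷ a ∷ [] → Full K e (T ∖ ⟪ a ∷ [] ⟫) (d ⊕ t ⊕ c st)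
        new {d} d∈ (here refl) = full-resp K (⊕-cong (≡⇒≈ (sym (identʳ d))) ≈-refl) (full-mono K id proj₁ (reach st d∈))
        new {d} d∈ (there (here refl)) = full-resp K eq
            (full-mono K ⊥-elim id (full-⊕ K {T′ = T ∖ ⟪ a ∷ [] ⟫} a∈S a∈T (λ (_ , h) → h (here refl)) proj₁ (reach st d∈)))
          where
          open ≈-Reasoning
          eq : d ⊕ c st ⊕ a ≈ d ⊕ a ⊕ c st
          eq = begin
            d ⊕ c st ⊕ a    ≡⟨ assoc d _ a ⟩
            d ⊕ (c st ⊕ a)  ≈⟨ ⊕-cong ≈-refl (central′ a∈ (c st)) ⟨
            d ⊕ (a ⊕ c st)  ≡⟨ assoc d a _ ⟨
            d ⊕ a ⊕ c st ∎

      -- Once b = r the remaining elements are left alone, whence the minimum with r. Nothing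
      -- outside K′ is spent, so the slices stay available.
      add-singles : ∀ {e} as T b → Stage e T b → 0 < b → b ≤ r → T ⊆ S → Unique as →
                    All (_∈ T ∩ (set′ ∖ set)) as →
                    Σ (DSet n) λ T′ → T′ ⊆ T ⊗ (T ∖ set′) ⊆ T′ ⊗ Stage e T′ (r ⊓ (b + length as))
      add-singles {e} [] T b st b>0 b≤r T⊆S u all = T , id , proj₁ ,
        subst (Stage e T) (sym (trans (cong (r ⊓_) (+-identityʳ b)) (m≥n⇒m⊓n≡n b≤r))) st
      add-singles {e} (a ∷ as) T b st b>0 b≤r T⊆S (a∉ ∷ u) ((a∈T , a∈′ , a∉K) ∷ all) with b ≟ r
      ... | yes refl = T , id , proj₁ , subst (Stage e T) (sym (m≤n⇒m⊓n≡m (m≤m+n b _))) st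
      ... | no b≢r =
        let (T′ , T′⊆ , keep , st′) = add-singles as (T ∖ ⟪ a ∷ [] ⟫) (suc b)
              (add-single st b>0 b<r (T⊆S a∈T) a∈T a∈′ a∉K) (s≤s z≤n) b<r (T⊆S ∘ proj₁) u
              (All.zipWith (λ { (a≢x , x∈T , h) → (x∈T , λ { (here x≡a) → a≢x (sym x≡a) }) , h }) (a∉ , all))
        in T′ , proj₁ ∘ T′⊆ , (λ (x∈ , x∉) → keep ((x∈ , λ { (here refl) → x∉ a∈′ }) , x∉)) ,
           subst (Stage e T′) (cong (r ⊓_) (sym (+-suc b (length as)))) st′
        where b<r = ≤∧≢⇒< b≤r b≢r

      -- Exactly one element of `as` is used, so no sum is empty afterwards and the flag becomes
      -- `⊥`. Subtracting w moves `as` into K′, and w is absorbed by the new base point c ⊕ w.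
      add-transversal : ∀ {e T b w} as → Stage e T b → 0 < b → 0 < length as → b + length as ≤ suc r → T ⊆ S →
                        AllPairs (λ x y → ¬ (x ≈ y)) as → All (_∈ T) as → All (λ a → w Mod′.≈ a) as →
                        Stage ⊥ (T ∖ ⟪ as ⟫) (b + length as ∸ 1)
      add-transversal {e} {T} {b} {w} as st b>0 as≠[] b≤r T⊆S ≉as as⊆T as≈w =
        subst (λ l → Stage ⊥ (T ∖ ⟪ as ⟫) (b + l ∸ 1)) (List.length-map (⊖ w ⊕_) as)
          (grow (map (⊖ w ⊕_) as) {c st ⊕ w} st b>0 (subst (0 <_) (sym (List.length-map (⊖ w ⊕_) as)) as≠[])
            (AllPairs.map⁺ (AllPairs.map (λ ne p → ne (≈-cancelˡ (⊖ w) p)) ≉as)) (All.map⁺ as≈w) new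
            (subst (λ l → b + l ≤ suc r) (sym (List.length-map (⊖ w ⊕_) as)) b≤r))
        where
        new : ∀ {d t} → d ∈ X st → t ∈ₗ map (⊖ w ⊕_) as → Full K ⊥ (T ∖ ⟪ as ⟫) (d ⊕ t ⊕ (c st ⊕ w))
        new {d} d∈ t∈ with Mem.∈-map⁻ (⊖ w ⊕_) t∈
        ... | a , a∈ , refl = full-resp K eq
            (full-⊕ K (T⊆S (All.lookup as⊆T a∈)) (All.lookup as⊆T a∈) (λ (_ , h) → h a∈) proj₁ (reach st d∈))
          where
          open ≈-Reasoning
          t = ⊖ w ⊕ a
          eq : d ⊕ c st ⊕ a ≈ d ⊕ t ⊕ (c st ⊕ w)
          eq = begin
            d ⊕ c st ⊕ a            ≡⟨ cong (d ⊕ c st ⊕_) (\\-leftDividesˡ w a) ⟨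
            d ⊕ c st ⊕ (w ⊕ t)      ≡⟨ assoc _ w t ⟨
            d ⊕ c st ⊕ w ⊕ t        ≡⟨ cong (_⊕ t) (assoc d _ w) ⟩
            d ⊕ (c st ⊕ w) ⊕ t      ≡⟨ assoc d _ t ⟩
            d ⊕ (c st ⊕ w ⊕ t)      ≈⟨ ⊕-cong (≈-refl {d}) (central′ (All.lookup as≈w a∈) _) ⟨
            d ⊕ (t ⊕ (c st ⊕ w))    ≡⟨ assoc d t _ ⟨
            d ⊕ t ⊕ (c st ⊕ w) ∎

      Slice : DSet n → DSet n → Set
      Slice pool A = ∀ {g h} → g ∈ pool ∩ A → h ∈ pool ∩ A → g Mod′.≈ h ⊗ (g ≈ h → g ≡ h)

      add-slices : ∀ {e} As pool T b → Stage e T b → 0 < b → b ≤ r → T ⊆ S → pool ⊆ T →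
                   (∀ {g} → g ∈ pool → Any (g ∈_) As) → All (Slice pool) As →
                   b ≡ r ⊎ r + length As ≤ b + count pool →
                   Σ (DSet n) λ T′ → T′ ⊆ T ⊗ count (T ∖ set′) ≤ count (T′ ∖ set′) + 2 * (r ∸ b) ⊗
                   Stage (e ⊗ b ≡ r) T′ r
      add-slices {e} As pool T b st b>0 b≤r T⊆S pool⊆ cover slices hyp with b ≟ r
      ... | yes refl = T , id , m≤m+n _ _ , stage-mono (_, refl) id st
      add-slices [] pool T b st b>0 b≤r T⊆S pool⊆ cover slices hyp | no b≢r with hyp
      ... | inj₁ b≡r = contradiction b≡r b≢r
      ... | inj₂ le = contradiction (≤-antisym b≤r (subst₂ _≤_ (+-identityʳ r)
              (trans (cong (b +_) (count≡0 pool λ g g∈ → case cover g∈ of λ ())) (+-identityʳ b)) le)) b≢r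
      add-slices {e} (A ∷ As) pool T b st b>0 b≤r T⊆S pool⊆ cover (slice ∷ slices) hyp | no b≢r with hyp
      ... | inj₁ b≡r = contradiction b≡r b≢r
      ... | inj₂ le = go (count (pool ∩ A) ≤? 1)
        where
        b<r = ≤∧≢⇒< b≤r b≢r
        pool′ = pool ∖ A
        split = count-∖ pool A
        a = count (pool ∩ A)
        cover′ : ∀ {g} → g ∈ pool′ → Any (g ∈_) As
        cover′ (g∈ , g∉A) with cover g∈
        ... | here h = contradiction h g∉A
        ... | there h = h
        slices′ : All (Slice pool′) As
        slices′ = All.map (λ {B} → shrink {B}) slices
          where
          shrink : ∀ {B} → Slice pool B → Slice pool′ B
          shrink sl (g∈ , g∈B) (h∈ , h∈B) = sl (proj₁ g∈ , g∈B) (proj₁ h∈ , h∈B)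
        Goal = Σ (DSet n) λ T′ → T′ ⊆ T ⊗ count (T ∖ set′) ≤ count (T′ ∖ set′) + 2 * (r ∸ b) ⊗
                   Stage (e ⊗ b ≡ r) T′ r
        open ≤-Reasoning
        go : Dec (a ≤ 1) → Goal
        -- Such a slice gains nothing and is dropped: the left side of the hypothesis falls by 1,
        -- the right side by at most 1.
        go (yes a≤1) = add-slices As pool′ T b st b>0 b≤r T⊆S (pool⊆ ∘ proj₁) cover′ slices′ (inj₂ (s≤s⁻¹ (begin
            suc (r + length As)        ≡⟨ +-suc r (length As) ⟨
            r + length (A ∷ As)        ≤⟨ le ⟩
            b + count pool             ≡⟨ cong (b +_) split ⟩
            b + (a + count pool′)      ≤⟨ +-monoʳ-≤ b (+-monoˡ-≤ _ a≤1) ⟩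
            b + suc (count pool′)      ≡⟨ +-suc b _ ⟩
            suc (b + count pool′) ∎)))
        go (no a≰1) =
          let (T′ , T′⊆ , cost , st″) = add-slices As pool′ (T ∖ ⟪ as ⟫) b′ st′ (≤-trans b>0 b≤b′) b′≤r (T⊆S ∘ proj₁)
                (λ (g∈ , g∉A) → pool⊆ g∈ , λ g∈as → g∉A (proj₂ (as⊆ g∈as))) cover′ slices′ hyp′
          in T′ , proj₁ ∘ T′⊆ , total T′ cost , stage-mono (λ ()) id st″
          where
          -- To get from b to r, a slice of r + 1 - b elements is enough; a longer one is truncated,
          -- since more elements would be lost without gain.
          k = a ⊓ (suc r ∸ b)
          as = take k (elems (pool ∩ A))
          as⊆ : ∀ {x} → x ∈ₗ as → x ∈ pool ∩ A
          as⊆ x∈ = elems⁻ (pool ∩ A) (∈-take k x∈)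
          u : Unique as
          u = Unique.take⁺ k (elems-! (pool ∩ A))
          len : length as ≡ k
          len = trans (List.length-take k _) (m≤n⇒m⊓n≡m (m⊓n≤m a _))
          room : 2 ≤ suc r ∸ b
          room = subst (_≤ suc r ∸ b) (m+n∸n≡m 2 b) (∸-monoˡ-≤ b (s≤s b<r))
          k≥2 : 2 ≤ k
          k≥2 = ⊓-glb (≰⇒> a≰1) room
          bk≤ : b + k ≤ suc r
          bk≤ = subst (b + k ≤_) (m+[n∸m]≡n (m≤n⇒m≤1+n b≤r)) (+-monoʳ-≤ b (m⊓n≤n a _))
          b′ = b + k ∸ 1
          suc-b′ : suc b′ ≡ b + k
          suc-b′ = m+[n∸m]≡n (≤-trans b>0 (m≤m+n b k))
          b≤b′ : b ≤ b′
          b≤b′ = s≤s⁻¹ (subst (suc b ≤_) (sym suc-b′) (subst (_≤ b + k) (+-comm b 1) (+-monoʳ-≤ b (<⇒≤ k≥2))))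
          b′≤r : b′ ≤ r
          b′≤r = s≤s⁻¹ (subst (_≤ suc r) (sym suc-b′) bk≤)
          pairs : ∀ {xs : List (Fin n)} → Unique xs → (∀ {x} → x ∈ₗ xs → x ∈ pool ∩ A) → AllPairs (λ x y → ¬ (x ≈ y)) xs
          pairs [] _ = []
          pairs (x∉ ∷ u) sub = All.tabulate (λ y∈ p → All.lookup x∉ y∈ (proj₂ (slice (sub (here refl)) (sub (there y∈))) p))
                               ∷ pairs u (sub ∘ there)
          st′ : Stage ⊥ (T ∖ ⟪ as ⟫) b′
          st′ with count>0⁻ (pool ∩ A) (<-≤-trans (s≤s z≤n) (<⇒≤ (≰⇒> a≰1)))
          ... | w , w∈ = subst (λ l → Stage ⊥ (T ∖ ⟪ as ⟫) (b + l ∸ 1)) len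
              (add-transversal {w = w} as st b>0 (subst (0 <_) (sym len) (<⇒≤ k≥2)) (subst (λ l → b + l ≤ suc r) (sym len) bk≤) T⊆S
                (pairs u as⊆) (All.tabulate (λ x∈ → pool⊆ (proj₁ (as⊆ x∈))))
                (All.tabulate (λ x∈ → proj₁ (slice w∈ (as⊆ x∈)))))
          hyp′ : b′ ≡ r ⊎ r + length As ≤ b′ + count pool′
          hyp′ with a ≤? (suc r ∸ b)
          ... | no a≰ = inj₁ (suc-injective (trans suc-b′ (trans (cong (b +_) (m≥n⇒m⊓n≡n (<⇒≤ (≰⇒> a≰)))) (m+[n∸m]≡n (m≤n⇒m≤1+n b≤r)))))
          ... | yes a≤ = inj₂ (s≤s⁻¹ (begin
              suc (r + length As)       ≡⟨ +-suc r (length As) ⟨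
              r + length (A ∷ As)       ≤⟨ le ⟩
              b + count pool            ≡⟨ cong (b +_) split ⟩
              b + (a + count pool′)     ≡⟨ +-assoc b a _ ⟨
              b + a + count pool′       ≡⟨ cong (λ t → b + t + count pool′) (m≤n⇒m⊓n≡m a≤) ⟨
              b + k + count pool′       ≡⟨ cong (_+ count pool′) suc-b′ ⟨
              suc (b′ + count pool′) ∎))
          total : ∀ T′ → count ((T ∖ ⟪ as ⟫) ∖ set′) ≤ count (T′ ∖ set′) + 2 * (r ∸ b′) →
                  count (T ∖ set′) ≤ count (T′ ∖ set′) + 2 * (r ∸ b)
          total T′ cost = begin
              count (T ∖ set′)                              ≤⟨ count-∖-list (T ∖ set′) as u ⟩
              count ((T ∖ set′) ∖ ⟪ as ⟫) + length as       ≤⟨ +-mono-≤ (count-mono ((T ∖ set′) ∖ ⟪ as ⟫) ((T ∖ ⟪ as ⟫) ∖ set′)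
                                                                  (λ ((x∈ , x∉) , x∉as) → (x∈ , x∉as) , x∉)) (≤-reflexive len) ⟩
              count ((T ∖ ⟪ as ⟫) ∖ set′) + k               ≤⟨ +-monoˡ-≤ k cost ⟩
              count (T′ ∖ set′) + 2 * (r ∸ b′) + k          ≡⟨ +-assoc (count (T′ ∖ set′)) _ k ⟩
              count (T′ ∖ set′) + (2 * (r ∸ b′) + k)        ≤⟨ +-monoʳ-≤ (count (T′ ∖ set′)) arith ⟩
              count (T′ ∖ set′) + 2 * (r ∸ b) ∎
            where
            r-b : r ∸ b ≡ (r ∸ b′) + (b′ ∸ b)
            r-b = sym (trans (sym (+-∸-assoc (r ∸ b′) b≤b′)) (cong (_∸ b) (m∸n+n≡m b′≤r)))
            k≡ : k ≡ suc (b′ ∸ b)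
            k≡ = +-cancelˡ-≡ b k _ (trans (sym suc-b′) (trans (cong suc (sym (m+[n∸m]≡n b≤b′))) (sym (+-suc b _))))
            x>0 : 1 ≤ b′ ∸ b
            x>0 = s≤s⁻¹ (subst (2 ≤_) k≡ k≥2)
            arith : 2 * (r ∸ b′) + k ≤ 2 * (r ∸ b)
            arith = begin
              2 * (r ∸ b′) + k                          ≡⟨ cong (2 * (r ∸ b′) +_) k≡ ⟩
              2 * (r ∸ b′) + (1 + (b′ ∸ b))             ≤⟨ +-monoʳ-≤ (2 * (r ∸ b′)) (+-monoˡ-≤ (b′ ∸ b) x>0) ⟩
              2 * (r ∸ b′) + ((b′ ∸ b) + (b′ ∸ b))      ≡⟨ double (r ∸ b′) (b′ ∸ b) ⟩
              2 * ((r ∸ b′) + (b′ ∸ b))                 ≡⟨ cong (2 *_) r-b ⟨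
              2 * (r ∸ b) ∎
              where
              double : ∀ x y → 2 * x + (y + y) ≡ 2 * (x + y)
              double = solve-∀

-- From one term of the series to the next, and the climb to G

module Levels {n : ℕ} (G : FiniteGroup n) (S : DSet n) where
  open FiniteGroup G
  open GroupTheory G
  open NilpotentGroups G
  open CauchyDavenport G
  open Sums S

  module Step {K : NormalSubgroup} {r : ℕ} (E : Extension K r) where
    open NormalSubgroup K
    open Mod K
    open Extend E
    open NormalSubgroup K′ using () renaming (order to order″)
    open Mod K′ using () renaming (_≈_ to _≈′_; _≈?_ to _≈′?_; ≈-sym to ≈-sym′; ≈-trans to ≈-trans′; ≈0⇒∈ to ≈0⇒∈′; ∈⇒≈0 to ∈⇒≈0′)

    inner : DSet n → DSet n
    inner T = T ∩ (set′ ∖ set)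

    count-outside : ∀ T → count (T ∖ set) ≡ count (inner T) + count (T ∖ set′)
    count-outside T = count-⊎ (T ∖ set) (inner T) (T ∖ set′) split
        (λ (x∈ , _ , x∉) → x∈ , x∉) (λ (x∈ , x∉) → x∈ , x∉ ∘ K⊆K′) (λ (_ , x∈ , _) (_ , x∉) → x∉ x∈)
      where
      split : ∀ {x} → x ∈ T ∖ set → x ∈ inner T ⊎ x ∈ T ∖ set′
      split {x} (x∈ , x∉) with mem? set′ x
      ... | yes x∈′ = inj₁ (x∈ , x∈′ , x∉)
      ... | no x∉′ = inj₂ (x∈ , x∉′)

    count-inner : ∀ T → count (inner T) + order ≤ r * order
    count-inner T = begin
        count (inner T) + order             ≤⟨ +-monoˡ-≤ order (count-mono (inner T) (set′ ∖ set) proj₂) ⟩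
        count (set′ ∖ set) + order          ≡⟨ +-comm _ order ⟩
        order + count (set′ ∖ set)          ≡⟨ cong (_+ count (set′ ∖ set)) (count-cong set (set′ ∩ set) (λ x∈ → K⊆K′ x∈ , x∈) proj₂) ⟩
        count (set′ ∩ set) + count (set′ ∖ set) ≡⟨ count-∖ set′ set ⟨
        count set′                          ≡⟨ order′ ⟩
        r * order ∎
      where open ≤-Reasoning

    -- The single elements of `inner T` come first: they alone fill min(r, 1 + |inner T|) cosets of
    -- K, so the slices have to supply only the rest, and only this rest is charged twice.
    ascend : ∀ {e T} → T ⊆ S → Covered K e T → ∀ As pool → pool ⊆ T ∖ set′ →
             (∀ {g} → g ∈ pool → Any (g ∈_) As) → All (Slice E pool) As →
             r + length As ≤ suc (count (inner T) + count pool) →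
             Σ (DSet n) λ T′ → T′ ⊆ T ⊗ count (T ∖ set′) ≤ count (T′ ∖ set′) + 2 * (r ∸ suc (count (inner T))) ⊗
             Covered K′ (e ⊗ r ≤ suc (count (inner T))) T′
    ascend {e} {T} T⊆S cov As pool pool⊆ cover slices le =
      let (T₁ , T₁⊆ , keep , st₁) = add-singles E (elems (inner T)) T 1 (start E cov) (s≤s z≤n) (prime>0 r-prime) T⊆S
                                      (elems-! (inner T)) (elems-All (inner T))
          (T₂ , T₂⊆ , cost , st₂) = add-slices E As pool T₁ b st₁ b>0 (m⊓n≤m r _) (T⊆S ∘ T₁⊆)
                                      (keep ∘ pool⊆) cover slices hyp
      in T₂ , T₁⊆ ∘ T₂⊆ , total T₁ T₂ keep cost ,
         finish E (stage-mono E (λ (x , b≡r) → x , subst (_≤ suc y) b≡r (m⊓n≤n r (suc y))) id st₂)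
      where
      open Extension E using (r-prime)
      prime>0 : ∀ {q} → Prime q → 1 ≤ q
      prime>0 pq = >-nonZero⁻¹ _ ⦃ prime⇒nonZero pq ⦄
      y = count (inner T)
      b = r ⊓ suc y
      b>0 : 0 < b
      b>0 = ⊓-glb (prime>0 r-prime) (s≤s z≤n)
      hyp : b ≡ r ⊎ r + length As ≤ b + count pool
      hyp with r ≤? suc y
      ... | yes r≤ = inj₁ (m≤n⇒m⊓n≡m r≤)
      ... | no r≰ = inj₂ (subst (λ t → r + length As ≤ t + count pool) (sym (m≥n⇒m⊓n≡n (<⇒≤ (≰⇒> r≰)))) le)
      r∸b : r ∸ b ≡ r ∸ suc y
      r∸b with r ≤? suc y
      ... | yes r≤ = trans (cong (r ∸_) (m≤n⇒m⊓n≡m r≤)) (trans (n∸n≡0 r) (sym (m≤n⇒m∸n≡0 r≤)))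
      ... | no r≰ = cong (r ∸_) (m≥n⇒m⊓n≡n (<⇒≤ (≰⇒> r≰)))
      total : ∀ T₁ T₂ → (T ∖ set′) ⊆ T₁ → count (T₁ ∖ set′) ≤ count (T₂ ∖ set′) + 2 * (r ∸ b) →
              count (T ∖ set′) ≤ count (T₂ ∖ set′) + 2 * (r ∸ suc y)
      total T₁ T₂ keep cost = ≤-trans (count-mono (T ∖ set′) (T₁ ∖ set′) (λ x∈ → keep x∈ , proj₂ x∈))
        (subst (λ t → count (T₁ ∖ set′) ≤ count (T₂ ∖ set′) + 2 * t) r∸b cost)

    -- Enumerating each K-coset of T by rank cuts T into transversals, as many in each K′-coset as its fullest K-coset has elements.
    module Ranks (T : DSet n) where

      below : Fin n → DSet n
      below g = T ∩ coset g ∩ record { mem = λ t → toℕ t < toℕ g ; mem? = λ t → toℕ t <? toℕ g }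

      rank : Fin n → ℕ
      rank g = count (below g)

      rank-< : ∀ {g h} → g ∈ T → g ≈ h → toℕ g < toℕ h → rank g < rank h
      rank-< {g} {h} g∈ g≈h lt = count-< (below g) (below h)
        (λ ((x∈ , q) , l) → (x∈ , ≈-trans (≈-sym g≈h) q) , <-trans l lt)
        ((g∈ , ≈-sym g≈h) , lt) (λ (_ , l) → <-irrefl refl l)

      rank-injective : ∀ {g h} → g ∈ T → h ∈ T → g ≈ h → rank g ≡ rank h → g ≡ h
      rank-injective {g} {h} g∈ h∈ g≈h eq with <-cmp (toℕ g) (toℕ h)
      ... | tri< lt _ _ = contradiction eq (<⇒≢ (rank-< g∈ g≈h lt))
      ... | tri≈ _ eq′ _ = Fin.toℕ-injective eq′
      ... | tri> _ _ gt = contradiction (sym eq) (<⇒≢ (rank-< h∈ (≈-sym g≈h) gt))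

      rank-bound : ∀ {g} → g ∈ T → rank g < count (T ∩ coset g)
      rank-bound {g} g∈ = count-< (below g) (T ∩ coset g) proj₁ (g∈ , ≈-refl) (λ (_ , l) → <-irrefl refl l)

      slice : Fin n → ℕ → DSet n
      mem (slice w k) g = w ≈′ g ⊗ rank g ≡ k
      mem? (slice w k) g = (w ≈′? g) ×-dec (rank g ≟ k)

      slice-Slice : ∀ {pool} → pool ⊆ T → ∀ w k → Slice E pool (slice w k)
      slice-Slice pool⊆ w k (g∈ , p , eq) (h∈ , q , eq′) =
        ≈-trans′ (≈-sym′ p) q , λ e → rank-injective (pool⊆ g∈) (pool⊆ h∈) e (trans eq (sym eq′))

      slices : List (Fin n) → ℕ → List (DSet n)
      slices [] κ = []
      slices (w ∷ ws) κ = map (slice w) (upTo κ) ++ slices ws κ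

      length-slices : ∀ ws κ → length (slices ws κ) ≡ length ws * κ
      length-slices [] κ = refl
      length-slices (w ∷ ws) κ = trans (List.length-++ (map (slice w) (upTo κ)))
        (cong₂ _+_ (trans (List.length-map (slice w) (upTo κ)) (List.length-upTo κ)) (length-slices ws κ))

      slices-Slice : ∀ {pool} → pool ⊆ T → ∀ ws κ → All (Slice E pool) (slices ws κ)
      slices-Slice pool⊆ [] κ = []
      slices-Slice {pool} pool⊆ (w ∷ ws) κ = All.++⁺
        (All.map⁺ (All.tabulate λ {k} _ → slice-Slice {pool} pool⊆ w k)) (slices-Slice {pool} pool⊆ ws κ)

      slices-cover : ∀ ws κ {g} → Any (_≈′ g) ws → g ∈ T → count (T ∩ coset g) ≤ κ → Any (g ∈_) (slices ws κ)
      slices-cover (w ∷ ws) κ (here p) g∈ le =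
        Any.++⁺ˡ (Any.map⁺ (Any.map (λ eq → p , eq) (Mem.∈-upTo⁺ (<-≤-trans (rank-bound g∈) le))))
      slices-cover (w ∷ ws) κ (there q) g∈ le = Any.++⁺ʳ (map (slice w) (upTo κ)) (slices-cover ws κ q g∈ le)

    count-coset-∩ : ∀ T g → count (T ∩ coset g) ≤ order
    count-coset-∩ T g = subst (count (T ∩ coset g) ≤_) (count-coset g) (count-mono (T ∩ coset g) (coset g) proj₂)

    -- `k` counts the K′-cosets that `P` leaves out, K′ itself included: 1 for all outer cosets, 2
    -- when one more coset is treated apart.
    outer-representatives : ∀ L → n ≡ suc L * (r * order) → (P : DSet n) → (∀ {x y} → x ≈′ y → x ∈ P → y ∈ P) → ∀ k →
      n ≡ count P + k * (r * order) →
      Σ (List (Fin n)) λ ws → (∀ {g} → g ∈ P → Any (_≈′ g) ws) ⊗ k + length ws ≡ suc L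
    outer-representatives L n≡ P resp k size =
      let (ws , _ , cover , eq) = coset-representatives K′ P resp in
      ws , cover , *-cancelʳ-≡ _ _ (r * order) ⦃ >-nonZero ro>0 ⦄ (begin
        (k + length ws) * (r * order)                ≡⟨ *-distribʳ-+ (r * order) k (length ws) ⟩
        k * (r * order) + length ws * (r * order)    ≡⟨ +-comm (k * (r * order)) _ ⟩
        length ws * (r * order) + k * (r * order)    ≡⟨ cong (λ t → length ws * t + k * (r * order)) order′ ⟨
        length ws * order″ + k * (r * order)         ≡⟨ cong (_+ k * (r * order)) eq ⟨
        count P + k * (r * order)                    ≡⟨ size ⟨
        n                                            ≡⟨ n≡ ⟩
        suc L * (r * order) ∎)
      where
      open ≡-Reasoning
      ro>0 : 0 < r * order
      ro>0 = subst (0 <_) order′ (order>0 K′)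

    outer : DSet n
    outer = full n ∖ set′

    outer-saturated : ∀ {x y} → x ≈′ y → x ∈ outer → y ∈ outer
    outer-saturated e (_ , x∉) = _ , λ y∈ → x∉ (≈0⇒∈′ (≈-trans′ (∈⇒≈0′ y∈) (≈-sym′ e)))

    outer-size : n ≡ count outer + 1 * (r * order)
    outer-size = begin
        n                                              ≡⟨ count-full n ⟨
        count (full n)                                 ≡⟨ count-∖ (full n) set′ ⟩
        count (full n ∩ set′) + count outer            ≡⟨ cong (_+ count outer) (count-cong (full n ∩ set′) set′ proj₂ (_ ,_)) ⟩
        order″ + count outer                           ≡⟨ cong (_+ count outer) order′ ⟩
        r * order + count outer                        ≡⟨ +-comm (r * order) _ ⟩
        count outer + r * order                        ≡⟨ cong (count outer +_) (*-identityˡ _) ⟨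
        count outer + 1 * (r * order) ∎
      where open ≡-Reasoning

    -- If no outer K-coset holds more than κ elements of T, then κ slices cover each of the L outer
    -- K′-cosets, L κ slices in total.
    ascend-capped : ∀ {e T} → T ⊆ S → Covered K e T → ∀ L κ → n ≡ suc L * (r * order) →
             (∀ {g} → g ∈ T ∖ set′ → count (T ∩ coset g) ≤ κ) →
             r + L * κ ≤ suc (count (T ∖ set)) →
             Σ (DSet n) λ T′ → T′ ⊆ T ⊗ count (T ∖ set′) ≤ count (T′ ∖ set′) + 2 * (r ∸ suc (count (inner T))) ⊗
             Covered K′ (e ⊗ r ≤ suc (count (inner T))) T′
    ascend-capped {e} {T} T⊆S cov L κ n≡ cap le =
      let (ws , cover , len) = outer-representatives L n≡ outer outer-saturated 1 outer-size
      in ascend T⊆S cov (slices ws κ) (T ∖ set′) id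
           (λ (g∈ , g∉) → slices-cover ws κ (cover (_ , g∉)) g∈ (cap (g∈ , g∉)))
           (slices-Slice {T ∖ set′} proj₁ ws κ)
           (subst₂ (λ s t → r + s ≤ suc t) (trans (cong (_* κ) (sym (suc-injective len))) (sym (length-slices ws κ))) (count-outside T) le)
      where open Ranks T

  module _ (nil : Nilpotent G) {p m : ℕ} (n≡ : n ≡ p * m) (e : ℕ) where

    -- A K-coset has |K| elements, so |K| always serves as the cap, and `good` together with the
    -- invariant is then exactly the room that `ascend-capped` asks for. The condition that |K|
    -- divides k restricts `good` to the primes that may still occur.
    climb : ∀ {f} fuel (K : NormalSubgroup) T → n ∸ NormalSubgroup.order K ≤ fuel →
            2 ≤ NormalSubgroup.order K →
            (∀ r k → Prime r → n ≡ r * k → NormalSubgroup.order K ∣ k → r + k ≤ suc (m + e)) →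
            T ⊆ S → Covered K f T → m + e ≤ count (T ∖ NormalSubgroup.set K) + NormalSubgroup.order K →
            Σ (DSet n) λ T′ → ∀ y → Reach f T′ y
    climb fuel K T le big good T⊆S cov inv with n ≤? NormalSubgroup.order K
    ... | yes n≤ = T , λ y → let (c , f) = cov in f y
            (count-⊆-≡ (NormalSubgroup.set K) (full n) _ (subst (_≤ NormalSubgroup.order K) (sym (count-full n)) n≤) _)
    climb {f} fuel K T le big good T⊆S cov inv | no n≰ with lagrange K
    ... | divides u n≡uM with prime-factor u u>1
      where
      u>1 : 1 < u
      u>1 = ≰⇒> λ u≤1 → n≰ (≤-trans (≤-reflexive n≡uM) (≤-trans (*-monoˡ-≤ (NormalSubgroup.order K) u≤1) (≤-reflexive (*-identityˡ _))))
    ... | r , pr , divides zero u≡ = contradiction (subst (0 <_) (trans n≡uM (cong (_* NormalSubgroup.order K) u≡)) n>0) (λ ())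
    ... | r , pr , divides (suc L) u≡ with fuel
    ... | zero = contradiction (m∸n≡0⇒m≤n (n≤0⇒n≡0 le)) n≰
    ... | suc fuel′ =
      let (T′ , T′⊆ , cost , cov′) = ascend-capped T⊆S cov L order n≡Lr (λ _ → count-coset-∩ T _) room
          (c , full′) = cov′
      in climb fuel′ K′ T′ (s≤s⁻¹ (≤-trans decrease le)) (≤-trans big (<⇒≤ bigger))
           (λ q k pq eq div → good q k pq eq (∣-trans (subst (order ∣_) (sym order′) (n∣m*n r)) div))
           (T⊆S ∘ T′⊆) (c , full-mono K′ proj₁ id full′) (inv′ T′ cost)
      where
      open NormalSubgroup K
      E : Extension K r
      E = extension nil K r pr (divides (suc L) (trans n≡uM (trans (cong (_* order) u≡) (*-assoc (suc L) r order))))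
      open Step E
      open Extend E
      n≡Lr : n ≡ suc L * (r * order)
      n≡Lr = trans n≡uM (trans (cong (_* order) u≡) (*-assoc (suc L) r order))
      n≡rk : n ≡ r * (suc L * order)
      n≡rk = trans n≡Lr (swap (suc L) r order)
        where
        swap : ∀ a b c → a * (b * c) ≡ b * (a * c)
        swap = solve-∀
      bigger : order < count set′
      bigger = subst (order <_) (sym order′) (m<k*m (order>0 K) (nonTrivial⇒n>1 r ⦃ prime⇒nonTrivial pr ⦄))
      decrease : n ∸ count set′ < n ∸ order
      decrease = ∸-monoʳ-< bigger (∣⇒≤ ⦃ >-nonZero n>0 ⦄ (lagrange K′))
      room : r + L * order ≤ suc (count (T ∖ set))
      room = +-cancelʳ-≤ order _ _ (begin
          r + L * order + order                ≡⟨ shuffle r L order ⟩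
          r + suc L * order                    ≤⟨ good r (suc L * order) pr n≡rk (n∣m*n (suc L)) ⟩
          suc (m + e)                          ≤⟨ s≤s inv ⟩
          suc (count (T ∖ set)) + order ∎)
        where
        open ≤-Reasoning
        shuffle : ∀ r L o → r + L * o + o ≡ r + (o + L * o)
        shuffle = solve-∀
      inv′ : ∀ T′ → count (T ∖ set′) ≤ count (T′ ∖ set′) + 2 * (r ∸ suc (count (inner T))) →
             m + e ≤ count (T′ ∖ set′) + count set′
      inv′ T′ cost = begin
          m + e                                            ≤⟨ inv ⟩
          count (T ∖ set) + order                          ≡⟨ cong (_+ order) (count-outside T) ⟩
          y + count (T ∖ set′) + order                     ≤⟨ +-monoˡ-≤ order (+-monoʳ-≤ y cost) ⟩
          y + (t′ + 2 * (r ∸ suc y)) + order               ≡⟨ shuffle y t′ (2 * (r ∸ suc y)) order ⟩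
          t′ + (y + 2 * (r ∸ suc y) + order)               ≤⟨ +-monoʳ-≤ t′ (used (r ≤? suc y)) ⟩
          t′ + r * order                                   ≡⟨ cong (t′ +_) order′ ⟨
          t′ + count set′ ∎
        where
        open ≤-Reasoning
        y = count (inner T)
        t′ = count (T′ ∖ set′)
        shuffle : ∀ y t u o → y + (t + u) + o ≡ t + (y + u + o)
        shuffle = solve-∀
        -- If r ≤ 1 + y, no slice was used and only `inner T` is gone. Otherwise the loss is at most
        -- 2 (y + s) ≤ |K| (y + s), which is where |K| ≥ 2 is needed.
        used : Dec (r ≤ suc y) → y + 2 * (r ∸ suc y) + order ≤ r * order
        used (yes r≤) = begin
          y + 2 * (r ∸ suc y) + order    ≡⟨ cong (λ t → y + 2 * t + order) (m≤n⇒m∸n≡0 r≤) ⟩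
          y + 0 + order                  ≡⟨ cong (_+ order) (+-identityʳ y) ⟩
          y + order                      ≤⟨ count-inner T ⟩
          r * order ∎
        used (no r≰) = begin
          y + 2 * s + order              ≤⟨ +-monoˡ-≤ order (+-monoˡ-≤ (2 * s) (m≤n*m y 2)) ⟩
          2 * y + 2 * s + order          ≡⟨ cong (_+ order) (*-distribˡ-+ 2 y s) ⟨
          2 * (y + s) + order            ≤⟨ +-monoˡ-≤ order (*-monoˡ-≤ (y + s) big) ⟩
          order * (y + s) + order        ≡⟨ regroup y s order ⟩
          (suc y + s) * order            ≡⟨ cong (_* order) (m+[n∸m]≡n (<⇒≤ (≰⇒> r≰))) ⟩
          r * order ∎
          where
          s = r ∸ suc y
          regroup : ∀ y s o → o * (y + s) + o ≡ (1 + y + s) * o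
          regroup = solve-∀

-- Numerical bounds

odd-form : ∀ k → ¬ (2 ∣ k) → ∃ λ h → k ≡ suc (h * 2)
odd-form zero ¬2 = contradiction (2 ∣0) ¬2
odd-form (suc zero) _ = 0 , refl
odd-form (suc (suc k)) ¬2 = let (h , eq) = odd-form k (λ 2∣k → ¬2 (∣m∣n⇒∣m+n ∣-refl 2∣k)) in suc h , cong (2 +_) eq

positive : ∀ {k} → 0 < k → ∃ λ L → k ≡ suc L
positive {suc L} _ = L , refl

-- For t = |T ∖ K₁| and m = p (L + 1). With p slices in each of the L outer K₂-cosets, t ≥ m - p
-- would fall short by p - 1; with p - 1 slices in each, L ≥ p - 1 slices are saved.
thin-bound : ∀ p L t .⦃ _ : NonZero p ⦄ → p ≤ suc L → p * suc L ≤ t + p → p + L * (p ∸ 1) ≤ suc t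
thin-bound (suc q) L t q≤L le = linarith 0 (+-mono-≤ q≤L le) (identity q L t)
  where
  identity : ∀ q L t → 1 + q + L * q + (1 + L + (t + (1 + q))) + 0 ≡ 1 + t + (1 + q + (1 + q) * (1 + L))
  identity = solve-∀

-- For t = |T ∖ K₁| and m = p (l + 2). With p slices in each of the l + 1 outer K₂-cosets, t ≥ m - 2
-- falls short by exactly 1, and one coset with p - 1 slices makes up for it.
gap-bound : ∀ p l t .⦃ _ : NonZero p ⦄ → p * (2 + l) ≤ t + 2 → p + (l * p + 1 * (p ∸ 1)) ≤ suc t
gap-bound (suc q) l t le = linarith 0 le (identity q l t)
  where
  identity : ∀ q l t → 1 + q + (l * (1 + q) + 1 * q) + (t + 2) + 0 ≡ 1 + t + (1 + q) * (2 + l)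
  identity = solve-∀

two-members : ∀ {n} (P : DSet n) → 2 ≤ count P → ∃ λ a → ∃ λ b → a ∈ P ⊗ b ∈ P ⊗ a ≢ b
two-members P le = go (elems P) (elems-! P) (elems⁻ P) le
  where
  go : ∀ xs → Unique xs → (∀ {x} → x ∈ₗ xs → x ∈ P) → 2 ≤ length xs → ∃ λ a → ∃ λ b → a ∈ P ⊗ b ∈ P ⊗ a ≢ b
  go (a ∷ b ∷ _) ((a≢b ∷ _) ∷ _) sub _ = a , b , sub (here refl) , sub (there (here refl)) , a≢b
  go (_ ∷ []) _ _ (s≤s ())

-- Inclusion-exclusion for two sets A and B inside a set of q elements, with c = |A ∩ B| and d = |A
-- ∖ B|: c ≥ a + b - q ≥ 2 (1 + s) - q ≥ 2.
two-bound : ∀ a c d b s q → a ≡ c + d → a ≡ 1 + s → a ≤ b → d + b ≤ q → q ≤ 2 * s → 2 ≤ c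
two-bound a c d b s q refl a≡ a≤b d+b≤q q≤ =
  linarith 0 (+-mono-≤ (+-mono-≤ d+b≤q q≤) (+-mono-≤ a≤b (≤-trans (≤-reflexive (cong (2 *_) (sym a≡))) ≤-refl)))
    (identity c d b s q)
  where
  identity : ∀ c d b s q → 2 + (q + 2 * s + (b + 2 * (c + d))) + 0 ≡ c + (d + b + q + (c + d + 2 * (1 + s)))
  identity = solve-∀

-- Giving up S ∩ K₂ costs at most p² - 1 elements, since 𝟘 is not in S, while |K₂| contributes p².
-- The difference of 1 turns m + p - 2 into m + p - 1.
dense-bound : ∀ m p c y u v → m + p ≤ c + 2 → c ≡ y + u → y < p * p → u ≤ v → m + (p ∸ 1) ≤ v + p * p
dense-bound m zero c y u v le c≡ () _
dense-bound m (suc q) c y u v le refl lt u≤v = linarith 0 (+-mono-≤ le (+-mono-≤ lt u≤v)) (identity m q y u v)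
  where
  identity : ∀ m q y u v → m + q + (y + u + 2 + ((1 + q) * (1 + q) + v)) + 0 ≡ v + (1 + q) * (1 + q) + (m + (1 + q) + (1 + y + u))
  identity = solve-∀

-- The upper bound: the first level and the case p ∤ m

module UpperBound {n : ℕ} (G : FiniteGroup n) (nil : Nilpotent G) (2∤n : ¬ (2 ∣ n))
  {p m : ℕ} (pp : Prime p) (n≡pm : n ≡ p * m) (smallest : ∀ q → Prime q → q ∣ n → p ≤ q) (cm : Composite m)
  (S : DSet n) (0∉S : FiniteGroup.𝟘 G ∉ S) (S≥ : m + p ∸ 2 ≤ count S) where

  open FiniteGroup G
  open GroupTheory G
  open NilpotentGroups G
  open CauchyDavenport G
  open Sums S
  open Levels G S

  p∣n : p ∣ n
  p∣n = subst (p ∣_) (sym n≡pm) (m∣m*n m)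

  m∣n : m ∣ n
  m∣n = subst (m ∣_) (sym n≡pm) (n∣m*n p)

  p≥3 : 3 ≤ p
  p≥3 = ≤∧≢⇒< (nonTrivial⇒n>1 p ⦃ prime⇒nonTrivial pp ⦄) λ 2≡p → 2∤n (subst (_∣ n) (sym 2≡p) p∣n)

  p>0 : 0 < p
  p>0 = <-≤-trans (s≤s z≤n) p≥3

  instance
    p≢0 : NonZero p
    p≢0 = >-nonZero p>0

  divisor≥p : ∀ {d} → 1 < d → d ∣ n → p ≤ d
  divisor≥p {d} 1<d d∣n = let (q , pq , q∣d) = prime-factor d 1<d in
    ≤-trans (smallest q pq (∣-trans q∣d d∣n)) (∣⇒≤ ⦃ >-nonZero (<-trans (s≤s z≤n) 1<d) ⦄ q∣d)

  cofactor : ∀ {r k} → Prime r → r ≢ p → n ≡ r * k → ∃ λ j → k ≡ p * j ⊗ m ≡ r * j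
  cofactor {r} {k} pr r≢p n≡rk with euclidsLemma r k pp (subst (p ∣_) n≡rk p∣n)
  ... | inj₁ p∣r with prime⇒irreducible pr p∣r
  ... | inj₁ p≡1 = contradiction p≥3 (subst (λ t → ¬ (3 ≤ t)) (sym p≡1) λ { (s≤s ()) })
  ... | inj₂ p≡r = contradiction (sym p≡r) r≢p
  cofactor {r} {k} pr r≢p n≡rk | inj₂ (divides j k≡) = j , trans k≡ (*-comm j p) , *-cancelˡ-≡ m (r * j) p (begin
      p * m        ≡⟨ n≡pm ⟨
      n            ≡⟨ n≡rk ⟩
      r * k        ≡⟨ cong (r *_) k≡ ⟩
      r * (j * p)  ≡⟨ shuffle r j p ⟩
      p * (r * j) ∎)
    where
    open ≡-Reasoning
    shuffle : ∀ r j p → r * (j * p) ≡ p * (r * j)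
    shuffle = solve-∀

  m>0 : 0 < m
  m>0 = >-nonZero⁻¹ m ⦃ composite⇒nonZero cm ⦄

  factor>0 : ∀ {a b} → m ≡ a * b → 0 < b
  factor>0 {a} {zero} eq = contradiction (subst (0 <_) (trans eq (*-zeroʳ a)) m>0) (λ ())
  factor>0 {b = suc _} _ = s≤s z≤n

  -- For r ≠ p write k = p j and m = r j; then r + p j ≤ r j + p amounts to (r - p)(j - 1) ≥ 0. For
  -- r = p it is an equality.
  step-bound : ∀ r k → Prime r → n ≡ r * k → r + k ≤ suc (m + (p ∸ 1))
  step-bound r k pr n≡rk with r ≟ p
  ... | yes refl = ≤-reflexive (begin
      r + k             ≡⟨ cong (r +_) (*-cancelˡ-≡ k m r (trans (sym n≡rk) n≡pm)) ⟩
      r + m             ≡⟨ +-comm r m ⟩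
      m + r             ≡⟨ cong (m +_) (suc-pred r) ⟨
      m + suc (r ∸ 1)   ≡⟨ +-suc m _ ⟩
      suc (m + (r ∸ 1)) ∎)
    where open ≡-Reasoning
  ... | no r≢p with cofactor pr r≢p n≡rk
  ... | zero , _ , m≡ = contradiction (factor>0 {r} m≡) λ ()
  ... | suc j , k≡ , m≡ = begin
      r + k                          ≡⟨ cong (r +_) k≡ ⟩
      r + p * suc j                  ≡⟨ expand r p j ⟩
      r + p + p * j                  ≤⟨ +-monoʳ-≤ (r + p) (*-monoˡ-≤ j (smallest r pr (subst (r ∣_) (sym n≡rk) (m∣m*n k)))) ⟩
      r + p + r * j                  ≡⟨ collect r p j ⟩
      r * suc j + p                  ≡⟨ cong₂ _+_ m≡ (suc-pred p) ⟨
      m + suc (p ∸ 1)                ≡⟨ +-suc m _ ⟩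
      suc (m + (p ∸ 1)) ∎
    where
    open ≤-Reasoning
    expand : ∀ r p j → r + p * (1 + j) ≡ r + p + p * j
    expand = solve-∀
    collect : ∀ r p j → r + p + r * j ≡ r * (1 + j) + p
    collect = solve-∀

  -- Now r > p. Writing k = p j and m = r j, the factor j is not 1 because m is composite, so j ≥ p
  -- as a divisor of n. With r = p + 1 + s the claim is p + s ≤ (1 + s) j.
  step-bound-coprime : ¬ (p ∣ m) → ∀ r k → Prime r → n ≡ r * k → p ∣ k → r + k ≤ suc (m + 0)
  step-bound-coprime p∤m r k pr n≡rk p∣k = go (cofactor pr r≢p n≡rk)
    where
    r≢p : r ≢ p
    r≢p refl = p∤m (subst (r ∣_) (*-cancelˡ-≡ k m r (trans (sym n≡rk) n≡pm)) p∣k)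
    p<r : p < r
    p<r = ≤∧≢⇒< (smallest r pr (subst (r ∣_) (sym n≡rk) (m∣m*n k))) (r≢p ∘ sym)
    go : (∃ λ j → k ≡ p * j ⊗ m ≡ r * j) → r + k ≤ suc (m + 0)
    go (zero , _ , m≡) = contradiction (factor>0 {r} m≡) λ ()
    go (suc zero , _ , m≡) = contradiction (subst Prime (sym (trans m≡ (*-identityʳ r))) pr) (composite⇒¬prime cm)
    go (suc (suc i) , k≡ , m≡) = subst₂ (λ s t → r + s ≤ suc t) (sym k≡) (trans (sym m≡) (sym (+-identityʳ m))) (begin
        r + p * j                 ≡⟨ cong₂ (λ s t → s + p * t) r≡ refl ⟩
        suc p + s + p * j         ≤⟨ +-monoˡ-≤ (p * j) (+-monoˡ-≤ s (s≤s p≤j)) ⟩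
        suc j + s + p * j         ≤⟨ +-monoˡ-≤ (p * j) (+-monoʳ-≤ (suc j) (m≤m*n s j)) ⟩
        suc j + s * j + p * j     ≡⟨ collect j s p ⟩
        suc ((suc p + s) * j)     ≡⟨ cong (λ t → suc (t * j)) r≡ ⟨
        suc (r * j) ∎)
      where
      open ≤-Reasoning
      j = suc (suc i)
      s = r ∸ suc p
      r≡ : r ≡ suc p + s
      r≡ = sym (m+[n∸m]≡n p<r)
      p≤j : p ≤ j
      p≤j = divisor≥p (s≤s (s≤s z≤n)) (∣-trans (subst (j ∣_) (sym m≡) (n∣m*n r)) m∣n)
      collect : ∀ j s p → 1 + j + s * j + p * j ≡ 1 + (1 + p + s) * j
      collect = solve-∀

  S≥′ : m + p ≤ count S + 2
  S≥′ = subst (m + p ≤_) (+-comm 2 (count S)) (m∸n≤o⇒m≤n+o 2 S≥)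
    where
    m∸n≤o⇒m≤n+o : ∀ {a} b {c} → a ∸ b ≤ c → a ≤ b + c
    m∸n≤o⇒m≤n+o {a} b {c} h = ≤-trans (m≤n+m∸n a b) (+-monoʳ-≤ b h)

  abstract
    E₁ : Extension trivial p
    E₁ = extension nil trivial p pp (subst (λ t → p * t ∣ n) (sym order-trivial) (subst (_∣ n) (sym (*-identityʳ p)) p∣n))

  open Extend E₁ using () renaming (K′ to K₁; set′ to set₁)
  open Step E₁ using () renaming (inner to inner₀)
  module L₁ = Step E₁
  module M₀ = Mod trivial
  module M₁ = Mod K₁

  order₁ : count set₁ ≡ p
  order₁ = trans (Extend.order′ E₁) (trans (cong (p *_) order-trivial) (*-identityʳ p))

  x₁ : ℕ
  x₁ = count (inner₀ S)

  sx₁≤p : suc x₁ ≤ p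
  sx₁≤p = subst₂ _≤_ (trans (cong (x₁ +_) order-trivial) (+-comm x₁ 1)) (trans (cong (p *_) order-trivial) (*-identityʳ p)) (L₁.count-inner S)

  S-split : count S ≡ x₁ + count (S ∖ set₁)
  S-split = trans (count-cong S (S ∖ NormalSubgroup.set trivial) (λ x∈ → x∈ , λ { refl → 0∉S x∈ }) proj₁) (L₁.count-outside S)

  covered₀ : ∀ {T} → Covered trivial ⊤ T
  covered₀ = 𝟘 , λ y q → reached [] (λ _ → _) [] [] (sym (M₀.≈0⇒∈ q))

  n≡₁ : ∀ {L} → m ≡ suc L → n ≡ suc L * (p * NormalSubgroup.order trivial)
  n≡₁ {L} m≡ = trans n≡pm (trans (*-comm p m) (cong₂ _*_ m≡ (sym (trans (cong (p *_) order-trivial) (*-identityʳ p)))))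

  Solved : Set → Set₁
  Solved f = Σ (DSet n) λ T → ∀ y → Reach f T y

  -- The flag that `ascend` returns when it starts from `covered₀`: the empty sum stays available
  -- only if x₁ = p - 1, its largest possible value.
  OnlyK₁ : Set
  OnlyK₁ = ⊤ ⊗ p ≤ suc x₁

  -- Distinct elements are distinct modulo the trivial subgroup, so κ = 1 and each of the m - 1
  -- outer K₁-cosets is one slice. The room required, p + (m - 1) ≤ 1 + |S|, is precisely |S| ≥ m +
  -- p - 2.
  level-one : Σ (DSet n) λ T → T ⊆ S ⊗ count S + x₁ + 2 ≤ count (T ∖ set₁) + 2 * p ⊗ Covered K₁ OnlyK₁ T
  level-one =
    let (L , eq) = positive m>0
        (T , T⊆ , cost , cov) = L₁.ascend-capped {T = S} id covered₀ L 1 (n≡₁ eq) (λ {g} _ → subst (count (S ∩ M₀.coset g) ≤_) order-trivial (L₁.count-coset-∩ S g)) (room eq)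
    in T , T⊆ , bound (count (T ∖ set₁)) cost , cov
    where
    open ≤-Reasoning
    room : ∀ {L} → m ≡ suc L → p + L * 1 ≤ suc (count (S ∖ NormalSubgroup.set trivial))
    room {L} eq = s≤s⁻¹ (begin
        suc (p + L * 1)                  ≡⟨ shuffle p L ⟩
        suc L + p                        ≡⟨ cong (_+ p) eq ⟨
        m + p                            ≤⟨ S≥′ ⟩
        count S + 2                      ≡⟨ +-comm (count S) 2 ⟩
        2 + count S                      ≤⟨ s≤s (s≤s (count-mono S (S ∖ NormalSubgroup.set trivial) (λ x∈ → x∈ , λ { refl → 0∉S x∈ }))) ⟩
        2 + count (S ∖ NormalSubgroup.set trivial) ∎)
      where
      shuffle : ∀ p L → 1 + (p + L * 1) ≡ 1 + L + p
      shuffle = solve-∀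
    bound : ∀ t → count (S ∖ set₁) ≤ t + 2 * (p ∸ suc x₁) → count S + x₁ + 2 ≤ t + 2 * p
    bound t cost = begin
        count S + x₁ + 2                              ≡⟨ cong (λ c → c + x₁ + 2) S-split ⟩
        x₁ + count (S ∖ set₁) + x₁ + 2                ≤⟨ +-monoˡ-≤ 2 (+-monoˡ-≤ x₁ (+-monoʳ-≤ x₁ cost)) ⟩
        x₁ + (t + 2 * (p ∸ suc x₁)) + x₁ + 2          ≡⟨ shuffle x₁ t (p ∸ suc x₁) ⟩
        t + 2 * (suc x₁ + (p ∸ suc x₁))               ≡⟨ cong (λ c → t + 2 * c) (m+[n∸m]≡n sx₁≤p) ⟩
        t + 2 * p ∎
      where
      shuffle : ∀ x t s → x + (t + 2 * s) + x + 2 ≡ t + 2 * (1 + x + s)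
      shuffle = solve-∀

  p≥2 : 2 ≤ p
  p≥2 = ≤-trans (s≤s (s≤s z≤n)) p≥3

  solve-coprime : ¬ (p ∣ m) → Solved OnlyK₁
  solve-coprime p∤m =
    let (T , T⊆ , bound , cov) = level-one in
    climb nil {p} {m} n≡pm 0 n K₁ T (m∸n≤m n (count set₁)) (subst (2 ≤_) (sym order₁) p≥2)
      (λ r k pr eq div → step-bound-coprime p∤m r k pr eq (subst (_∣ k) order₁ div)) T⊆ cov (start-bound (count (T ∖ set₁)) bound)
    where
    start-bound : ∀ t → count S + x₁ + 2 ≤ t + 2 * p → m + 0 ≤ t + count set₁
    start-bound t bound = subst (λ o → m + 0 ≤ t + o) (sym order₁) (+-cancelʳ-≤ p _ _ (begin
        m + 0 + p                ≡⟨ cong (_+ p) (+-identityʳ m) ⟩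
        m + p                    ≤⟨ S≥′ ⟩
        count S + 2              ≤⟨ +-monoˡ-≤ 2 (m≤m+n (count S) x₁) ⟩
        count S + x₁ + 2         ≤⟨ bound ⟩
        t + 2 * p                ≡⟨ double t p ⟩
        t + p + p ∎))
      where
      open ≤-Reasoning
      double : ∀ t p → t + 2 * p ≡ t + p + p
      double = solve-∀

  -- For k = 2 h + 1, adding h × (2 × x) to x gives k × x = 𝟘, so x is determined by its double.
  -- Only multiples of a single element are combined, so commutativity is not an issue.
  halve : ∀ {k x y} → ¬ (2 ∣ k) → k × x ≡ 𝟘 → k × y ≡ 𝟘 → x ⊕ x ≡ y ⊕ y → x ≡ y
  halve {k} {x} {y} 2∤k kx ky eq = let (h , k≡) = odd-form k 2∤k in ⊕-cancelʳ ((h * 2) × x) x y (begin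
      x ⊕ (h * 2) × x    ≡⟨ cong (_× x) k≡ ⟨
      k × x              ≡⟨ trans kx (sym ky) ⟩
      k × y              ≡⟨ cong (_× y) k≡ ⟩
      y ⊕ (h * 2) × y    ≡⟨ cong (y ⊕_) (×-assocˡ y h 2) ⟨
      y ⊕ h × (2 × y)    ≡⟨ cong (λ t → y ⊕ h × t) double ⟨
      y ⊕ h × (2 × x)    ≡⟨ cong (y ⊕_) (×-assocˡ x h 2) ⟩
      y ⊕ (h * 2) × x ∎)
    where
    open ≡-Reasoning
    double : 2 × x ≡ 2 × y
    double = trans (cong (x ⊕_) (identʳ x)) (trans eq (cong (y ⊕_) (sym (identʳ y))))

  -- The upper bound: the case p ∣ m

  module Divisible {m′ : ℕ} (m≡ : m ≡ p * m′) where

    n≡pp : n ≡ m′ * (p * p)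
    n≡pp = trans n≡pm (trans (cong (p *_) m≡) (shuffle p m′))
      where
      shuffle : ∀ p m → p * (p * m) ≡ m * (p * p)
      shuffle = solve-∀

    m′>1 : 1 < m′
    m′>1 = ≤∧≢⇒< (factor>0 {p} m≡) λ 1≡m′ → composite⇒¬prime cm
      (subst Prime (sym (trans m≡ (trans (cong (p *_) (sym 1≡m′)) (*-identityʳ p)))) pp)

    m′≥p : p ≤ m′
    m′≥p = divisor≥p m′>1 (∣-trans (subst (m′ ∣_) (sym m≡) (n∣m*n p)) m∣n)

    abstract
      E₂ : Extension K₁ p
      E₂ = extension nil K₁ p pp (subst (λ t → p * t ∣ n) (sym order₁) (divides m′ n≡pp))

    open Extend E₂ using () renaming (K′ to K₂; set′ to set₂)
    module L₂ = Step E₂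
    module M₂ = Mod K₂

    order₂ : count set₂ ≡ p * p
    order₂ = trans (Extend.order′ E₂) (cong (p *_) order₁)

    n≡₂ : ∀ {L} → m′ ≡ suc L → n ≡ suc L * (p * NormalSubgroup.order K₁)
    n≡₂ {L} eq = trans n≡pp (cong₂ (λ s t → s * (p * t)) eq (sym order₁))

    climb₂ : ∀ {f T} → T ⊆ S → Covered K₂ f T → m + (p ∸ 1) ≤ count (T ∖ set₂) + p * p → Solved f
    climb₂ {T = T} T⊆ cov inv = climb nil {p} {m} n≡pm (p ∸ 1) n K₂ T (m∸n≤m n (count set₂))
      (subst (2 ≤_) (sym order₂) (≤-trans p≥2 (m≤m*n p p)))
      (λ r k pr eq _ → step-bound r k pr eq) T⊆ cov (subst (λ o → m + (p ∸ 1) ≤ count (T ∖ set₂) + o) (sym order₂) inv)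

    Ascended : Set → DSet n → Set₁
    Ascended f T = Σ (DSet n) λ T′ → T′ ⊆ T ⊗
      count (T ∖ set₂) ≤ count (T′ ∖ set₂) + 2 * (p ∸ suc (count (L₂.inner T))) ⊗ Covered K₂ f T′

    -- From |T ∖ K₁| ≥ m - p it remains to show y + 2 (p ∸ suc y) + p + (p - 1) ≤ p² for y = |inner
    -- T|. If p ≤ 1 + y, use 2 y < p². In both cases (p - 1)(p - 3) ≥ 0 decides, which is the slack
    -- given to `linarith` with q = p - 3.
    finish₂ : ∀ {f T} → T ⊆ S → 2 * count (S ∩ set₂) < p * p → m ≤ count (T ∖ set₁) + p → Ascended f T → Solved f
    finish₂ {T = T} T⊆ few large (T′ , T′⊆ , cost , cov) = climb₂ (T⊆ ∘ T′⊆) cov (begin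
        m + (p ∸ 1)                                       ≤⟨ +-monoˡ-≤ (p ∸ 1) large ⟩
        count (T ∖ set₁) + p + (p ∸ 1)                    ≡⟨ cong (λ t → t + p + (p ∸ 1)) (L₂.count-outside T) ⟩
        y + count (T ∖ set₂) + p + (p ∸ 1)                ≤⟨ +-monoˡ-≤ (p ∸ 1) (+-monoˡ-≤ p (+-monoʳ-≤ y cost)) ⟩
        y + (t′ + 2 * (p ∸ suc y)) + p + (p ∸ 1)          ≡⟨ shuffle y t′ (2 * (p ∸ suc y)) p (p ∸ 1) ⟩
        t′ + (y + 2 * (p ∸ suc y) + p + (p ∸ 1))          ≤⟨ +-monoʳ-≤ t′ (used p≥3 y 2y<) ⟩
        t′ + p * p ∎)
      where
      open ≤-Reasoning
      y = count (L₂.inner T)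
      t′ = count (T′ ∖ set₂)
      2y< : 2 * y < p * p
      2y< = ≤-<-trans (*-monoʳ-≤ 2 (count-mono (L₂.inner T) (S ∩ set₂) λ (x∈ , x∈₂ , _) → T⊆ x∈ , x∈₂)) few
      shuffle : ∀ y t u p q → y + (t + u) + p + q ≡ t + (y + u + p + q)
      shuffle = solve-∀
      used : ∀ {p} → 3 ≤ p → ∀ y → 2 * y < p * p → y + 2 * (p ∸ suc y) + p + (p ∸ 1) ≤ p * p
      used {p} 3≤p y 2y< with p ≤? suc y | m≤n⇒∃[o]m+o≡n 3≤p
      ... | yes p≤ | q , refl = subst (λ s → y + 2 * s + p + (p ∸ 1) ≤ p * p) (sym (m≤n⇒m∸n≡0 p≤))
            (*-cancelˡ-≤ 2 (linarith (q * q + 2 * q) 2y< (identity y q)))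
        where
        identity : ∀ y q → 2 * (y + 2 * 0 + (3 + q) + (2 + q)) + (3 + q) * (3 + q) + (q * q + 2 * q)
                         ≡ 2 * ((3 + q) * (3 + q)) + (1 + 2 * y)
        identity = solve-∀
      ... | no p≰ | q , refl with m≤n⇒∃[o]m+o≡n (≰⇒> p≰)
      ... | s , eq = subst (λ t → y + 2 * t + p + (p ∸ 1) ≤ p * p) (sym p∸)
            (linarith (q * q + 2 * q + y) (≤-reflexive (cong (2 *_) (suc-injective (suc-injective eq)))) (identity y q s))
        where
        p∸ : p ∸ suc y ≡ suc s
        p∸ = trans (cong (_∸ suc y) (trans (sym eq) (sym (+-suc (suc y) s)))) (m+n∸m≡n (suc y) (suc s))
        identity : ∀ y q s → y + 2 * (1 + s) + (3 + q) + (2 + q) + 2 * (1 + q) + (q * q + 2 * q + y)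
                           ≡ (3 + q) * (3 + q) + 2 * (y + s)
        identity = solve-∀

    FullIn : DSet n → Fin n → Set
    FullIn T g = ∀ h → g M₁.≈ h → h ∈ T

    fullIn? : ∀ T g → Dec (FullIn T g)
    fullIn? T g = Fin.all? λ h → (g M₁.≈? h) →-dec mem? T h

    gap : ∀ T g → ¬ FullIn T g → ∃ λ h → g M₁.≈ h ⊗ h ∉ T
    gap T g ¬full with Fin.¬∀⟶∃¬ n _ (λ h → (g M₁.≈? h) →-dec mem? T h) ¬full
    ... | h , ¬imp with g M₁.≈? h
    ... | yes e = h , e , λ h∈ → ¬imp (λ _ → h∈)
    ... | no ne = contradiction (λ e → contradiction e ne) ¬imp

    gap-count : ∀ {T g} → (∃ λ h → g M₁.≈ h ⊗ h ∉ T) → count (T ∩ M₁.coset g) ≤ p ∸ 1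
    gap-count {T} {g} (h , e , h∉) = s≤s⁻¹ (subst (suc (count (T ∩ M₁.coset g)) ≤_)
      (trans (trans (M₁.count-coset g) order₁) (sym (suc-pred p)))
      (count-< (T ∩ M₁.coset g) (M₁.coset g) proj₂ e (λ (h∈ , _) → h∉ h∈)))

    forget-flag : ∀ {f T T′} → T′ ⊆ T → count (T ∖ set₂) ≤ count (T′ ∖ set₂) + 2 * (p ∸ suc (count (L₂.inner T))) →
                  Covered K₂ (f ⊗ p ≤ suc (count (L₂.inner T))) T′ → Ascended f T
    forget-flag {T′ = T′} T′⊆ cost (c , f) = T′ , T′⊆ , cost , c , full-mono K₂ proj₁ id f

    -- Without full K₁-cosets outside K₂ the cap is p - 1 instead of p, and the index m′ ≥ p of K₂
    -- provides enough cosets to make up for the loss on the first level.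
    solve-thin : 2 * count (S ∩ set₂) < p * p → (∀ g → g ∉ set₂ → ¬ FullIn S g) → Solved OnlyK₁
    solve-thin few thin =
      let (L , eq) = positive (<-trans (s≤s z≤n) m′>1)
          (T , T⊆ , bound , cov) = level-one
          large = size (count (T ∖ set₁)) bound
          (T′ , T′⊆ , cost , cov′) = L₂.ascend-capped {T = T} T⊆ cov L (p ∸ 1) (n≡₂ eq)
            (λ {g} (_ , g∉) → thin-coset T T⊆ g (thin g g∉))
            (room eq (count (T ∖ set₁)) large)
      in finish₂ {OnlyK₁} {T} T⊆ few large (forget-flag {OnlyK₁} {T} {T′} T′⊆ cost cov′)
      where
      thin-coset : ∀ T → T ⊆ S → ∀ g → ¬ FullIn S g → count (T ∩ M₁.coset g) ≤ p ∸ 1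
      thin-coset T T⊆ g ¬full = let (h , e , h∉) = gap S g ¬full in gap-count {T} {g} (h , e , h∉ ∘ T⊆)
      size : ∀ t → count S + x₁ + 2 ≤ t + 2 * p → m ≤ t + p
      size t bound = linarith x₁ (+-mono-≤ S≥′ bound) (identity m t (count S) x₁ p)
        where
        identity : ∀ m t s x p → m + (s + 2 + (t + 2 * p)) + x ≡ t + p + (m + p + (s + x + 2))
        identity = solve-∀
      room : ∀ {L} → m′ ≡ suc L → ∀ t → m ≤ t + p → p + L * (p ∸ 1) ≤ suc t
      room {L} eq t le = thin-bound p L t (subst (p ≤_) eq m′≥p) (subst (_≤ t + p) (trans m≡ (cong (p *_) eq)) le)

    m≤x : ∀ {x} → count S ≤ x + p → m ≤ x + 2
    m≤x {x} le = linarith 0 (+-mono-≤ S≥′ le) (identity m x (count S) p)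
      where
      identity : ∀ m x s p → m + (s + 2 + (x + p)) + 0 ≡ x + 2 + (m + p + s)
      identity = solve-∀

    LevelOneFrom : Fin n → Set₁
    LevelOneFrom g = Σ (DSet n) λ T → T ⊆ S ⊗ m ≤ count (T ∖ set₁) + 2 ⊗ Covered K₁ ⊥ T ⊗
      (∃ λ h → g M₁.≈ h ⊗ h ∉ T) ⊗ (∀ {h} → h ∈ S ∖ set₁ → ¬ (g M₁.≈ h) → h ∈ T)

    -- The first level from S ∩ K₁ together with as few elements of one full K₁-coset as possible.
    level-one-from : ∀ g → g ∉ set₁ → FullIn S g → LevelOneFrom g
    level-one-from g g∉ full =
      let (T , T⊆ , keep , st) = add-singles E₁ (elems (inner₀ S)) S 1 (start E₁ {⊤} {S} covered₀) (s≤s z≤n) p>0 id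
                                   (elems-! (inner₀ S)) (elems-All (inner₀ S))
          inT : ∀ {h} → g M₁.≈ h → h ∈ T
          inT e = keep (full _ e , outside e)
          st′ = add-transversal E₁ {w = g} as (subst (Stage E₁ ⊤ T) (m≥n⇒m⊓n≡n sx₁≤p) st) (s≤s z≤n) as≠[] room T⊆
                  (AllPairs.map (λ ne q → ne (M₀≈⇒≡ q)) as!) (All.tabulate (λ x∈ → inT (as⊆ x∈))) (All.tabulate as⊆)
      in T ∖ ⟪ as ⟫ , (λ x∈ → T⊆ (proj₁ x∈)) , m≤x (size T keep) ,
         finish E₁ (subst (Stage E₁ ⊥ (T ∖ ⟪ as ⟫)) len≡p st′) ,
         removed T , (λ h∈ ne → keep h∈ , λ h∈as → ne (as⊆ h∈as))
      where
      outside : ∀ {h} → g M₁.≈ h → h ∉ set₁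
      outside e h∈ = g∉ (M₁.≈0⇒∈ (M₁.≈-trans (M₁.∈⇒≈0 h∈) (M₁.≈-sym e)))
      M₀≈⇒≡ : ∀ {x y} → x M₀.≈ y → x ≡ y
      M₀≈⇒≡ {x} {y} e = sym (trans (sym (\\-leftDividesˡ x y)) (trans (cong (x ⊕_) e) (identʳ x)))
      -- From 1 + x₁ cosets, one slice of p - x₁ elements leads exactly to p. In all x₁ + (p - x₁) =
      -- p elements are spent, so |T ∖ K₁| ≥ |S| - p. As p - x₁ ≥ 1, the coset of g is not full
      -- afterwards and every sum is nonempty.
      k = p ∸ x₁
      as = take k (elems (M₁.coset g))
      k≡ : k ≡ suc (p ∸ suc x₁)
      k≡ = sym (trans (cong suc (sym (pred[m∸n]≡m∸[1+n] p x₁))) (suc-pred k ⦃ >-nonZero (m<n⇒0<n∸m sx₁≤p) ⦄))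
      as⊆ : ∀ {x} → x ∈ₗ as → g M₁.≈ x
      as⊆ x∈ = elems⁻ (M₁.coset g) (∈-take k x∈)
      as! : Unique as
      as! = Unique.take⁺ k (elems-! (M₁.coset g))
      len : length as ≡ k
      len = trans (List.length-take k _) (m≤n⇒m⊓n≡m (≤-trans (m∸n≤m p x₁)
        (≤-reflexive (sym (trans (M₁.count-coset g) order₁)))))
      as≠[] : 0 < length as
      as≠[] = subst (0 <_) (sym (trans len k≡)) (s≤s z≤n)
      total : suc x₁ + length as ≡ suc p
      total = trans (cong (suc x₁ +_) len) (cong suc (m+[n∸m]≡n (<⇒≤ sx₁≤p)))
      room : suc x₁ + length as ≤ suc p
      room = ≤-reflexive total
      len≡p : suc x₁ + length as ∸ 1 ≡ p
      len≡p = cong (_∸ 1) total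
      removed : ∀ T → ∃ λ h → g M₁.≈ h ⊗ h ∉ T ∖ ⟪ as ⟫
      removed T = first as as⊆ as≠[]
        where
        first : ∀ xs → (∀ {x} → x ∈ₗ xs → g M₁.≈ x) → 0 < length xs → ∃ λ h → g M₁.≈ h ⊗ h ∉ T ∖ ⟪ xs ⟫
        first (x ∷ _) sub _ = x , sub (here refl) , λ (_ , h) → h (here refl)
      size : ∀ T → (S ∖ set₁) ⊆ T → count S ≤ count ((T ∖ ⟪ as ⟫) ∖ set₁) + p
      size T keep = begin
          count S                                             ≡⟨ S-split ⟩
          x₁ + count (S ∖ set₁)                               ≤⟨ +-monoʳ-≤ x₁ (count-∖-list (S ∖ set₁) as as!) ⟩
          x₁ + (count ((S ∖ set₁) ∖ ⟪ as ⟫) + length as)      ≤⟨ +-monoʳ-≤ x₁ (+-monoˡ-≤ (length as)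
                                                                   (count-mono ((S ∖ set₁) ∖ ⟪ as ⟫) ((T ∖ ⟪ as ⟫) ∖ set₁)
                                                                     (λ (x∈ , x∉) → (keep x∈ , x∉) , proj₂ x∈))) ⟩
          x₁ + (t + length as)                                ≡⟨ shuffle x₁ t (length as) ⟩
          t + (x₁ + length as)                                ≡⟨ cong (t +_) (suc-injective total) ⟩
          t + p ∎
        where
        open ≤-Reasoning
        t = count ((T ∖ ⟪ as ⟫) ∖ set₁)
        shuffle : ∀ x t a → x + (t + a) ≡ t + (x + a)
        shuffle = solve-∀

    m≤t+p : ∀ {t} → m ≤ t + 2 → m ≤ t + p
    m≤t+p {t} le = ≤-trans le (+-monoʳ-≤ t p≥2)

    outer-minus : Fin n → DSet n
    outer-minus w = L₂.outer ∖ M₂.coset w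

    outer-minus-size : ∀ w → w ∉ set₂ → n ≡ count (outer-minus w) + 2 * (p * NormalSubgroup.order K₁)
    outer-minus-size w w∉ = begin
        n                                                          ≡⟨ L₂.outer-size ⟩
        count L₂.outer + 1 * o                                     ≡⟨ cong (_+ 1 * o) (count-∖ L₂.outer (M₂.coset w)) ⟩
        count (L₂.outer ∩ M₂.coset w) + count (outer-minus w) + 1 * o  ≡⟨ cong (λ t → t + count (outer-minus w) + 1 * o) coset-size ⟩
        o + count (outer-minus w) + 1 * o                          ≡⟨ shuffle o (count (outer-minus w)) ⟩
        count (outer-minus w) + 2 * o ∎
      where
      open ≡-Reasoning
      o = p * NormalSubgroup.order K₁
      coset-size : count (L₂.outer ∩ M₂.coset w) ≡ o
      coset-size = trans (count-cong (L₂.outer ∩ M₂.coset w) (M₂.coset w) proj₂ (λ e → L₂.outer-saturated e (_ , w∉) , e))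
                         (trans (M₂.count-coset w) (Extend.order′ E₂))
      shuffle : ∀ o c → o + c + 1 * o ≡ c + 2 * o
      shuffle = solve-∀

    outer-minus-saturated : ∀ w {x y} → x M₂.≈ y → x ∈ outer-minus w → y ∈ outer-minus w
    outer-minus-saturated w e (x∈ , x∉) = L₂.outer-saturated e x∈ , λ f → x∉ (M₂.≈-trans f (M₂.≈-sym e))

    -- K₂ has index m′ ≥ p ≥ 3, so K₂ and the coset of w do not exhaust the group.
    another : ∀ w → w ∉ set₂ → ∃ (_∈ outer-minus w)
    another w w∉ = count>0⁻ (outer-minus w) (≰⇒> λ none → <⇒≱ (≤-trans p≥3 m′≥p) (*-cancelʳ-≤ m′ 2 (p * p) ⦃ m*n≢0 p p ⦄ (begin
        m′ * (p * p)                          ≡⟨ n≡pp ⟨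
        n                                     ≡⟨ outer-minus-size w w∉ ⟩
        count (outer-minus w) + 2 * (p * NormalSubgroup.order K₁) ≡⟨ cong₂ (λ s t → s + 2 * (p * t)) (n≤0⇒n≡0 none) order₁ ⟩
        2 * (p * p) ∎)))
      where open ≤-Reasoning

    -- A K₂-coset of T without full K₁-coset needs one slice less than the others.
    solve-gap : 2 * count (S ∩ set₂) < p * p → ∀ {g} → LevelOneFrom g → ∀ w → w ∉ set₂ →
                (∀ {T} → T ⊆ S → (∃ λ h → g M₁.≈ h ⊗ h ∉ T) → ∀ h → w M₂.≈ h → ¬ FullIn T h) → Solved ⊥
    solve-gap few (T , T⊆ , large , cov , g-gap , _) w w∉ gaps =
      let (L , eq) = positive (<-trans (s≤s z≤n) m′>1)
          (ws , cover , len) = L₂.outer-representatives L (n≡₂ eq) (outer-minus w) (outer-minus-saturated w) 2 (outer-minus-size w w∉)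
          (T′ , T′⊆ , cost , cov′) = L₂.ascend {T = T} T⊆ cov (slices ws p ++ slices (w ∷ []) (p ∸ 1)) (T ∖ set₂) id
            (λ {g} (g∈ , g∉) → in-slices ws cover g g∈ g∉)
            (All.++⁺ (slices-Slice {T ∖ set₂} proj₁ ws p) (slices-Slice {T ∖ set₂} proj₁ (w ∷ []) (p ∸ 1)))
            (room ws (trans len (sym eq)))
      in finish₂ {⊥} {T} T⊆ few (m≤t+p large) (forget-flag {⊥} {T} {T′} T′⊆ cost cov′)
      where
      open L₂.Ranks T
      in-slices : ∀ ws → (∀ {h} → h ∈ outer-minus w → Any (M₂._≈ h) ws) → ∀ h → h ∈ T → h ∉ set₂ →
                  Any (h ∈_) (slices ws p ++ slices (w ∷ []) (p ∸ 1))
      in-slices ws cover h h∈ h∉ = choose (w M₂.≈? h)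
        where
        choose : Dec (w M₂.≈ h) → Any (h ∈_) (slices ws p ++ slices (w ∷ []) (p ∸ 1))
        choose (yes e) = Any.++⁺ʳ (slices ws p) (slices-cover (w ∷ []) (p ∸ 1) (here e) h∈
                           (gap-count {T} {h} (gap T h (gaps {T} T⊆ g-gap h e))))
        choose (no ne) = Any.++⁺ˡ (slices-cover ws p (cover ((_ , h∉) , ne)) h∈
                           (subst (count (T ∩ M₁.coset h) ≤_) order₁ (L₂.count-coset-∩ T h)))
      room : ∀ ws → 2 + length ws ≡ m′ → p + length (slices ws p ++ slices (w ∷ []) (p ∸ 1)) ≤ suc (count (L₂.inner T) + count (T ∖ set₂))
      room ws len = subst₂ (λ s t → p + s ≤ suc t) (sym length≡) (L₂.count-outside T)
          (gap-bound p (length ws) (count (T ∖ set₁)) (subst (_≤ count (T ∖ set₁) + 2) (trans m≡ (cong (p *_) (sym len))) large))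
        where
        length≡ : length (slices ws p ++ slices (w ∷ []) (p ∸ 1)) ≡ length ws * p + 1 * (p ∸ 1)
        length≡ = trans (List.length-++ (slices ws p)) (cong₂ _+_ (length-slices ws p) (length-slices (w ∷ []) (p ∸ 1)))

    -- Two full K₁-cosets in one K₂-coset form p slices of two elements each, a total gain of p,
    -- where p - 1 is enough. The first level spent elements of K₁ and of the coset of g only, so
    -- both cosets are still intact in T.
    solve-pair : 2 * count (S ∩ set₂) < p * p → ∀ {g} → LevelOneFrom g → ∀ g₂ g₃ → g₂ ∉ set₂ → g₂ M₂.≈ g₃ → ¬ (g₂ M₁.≈ g₃) →
                 ¬ (g M₂.≈ g₂) → FullIn S g₂ → FullIn S g₃ → Solved ⊥
    solve-pair few {g} (T , T⊆ , large , cov , _ , keep) g₂ g₃ g₂∉ e₂₃ ne₂₃ ne full₂ full₃ =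
      let (T′ , T′⊆ , cost , cov′) = L₂.ascend {T = T} T⊆ cov (slices (g₂ ∷ []) p) pool pool⊆
            (λ {h} h∈ → slices-cover (g₂ ∷ []) p (here (near h∈)) (proj₁ (pool⊆ h∈))
                           (subst (count (T ∩ M₁.coset h) ≤_) order₁ (L₂.count-coset-∩ T h)))
            (slices-Slice {pool} (λ h∈ → proj₁ (pool⊆ h∈)) (g₂ ∷ []) p) room
      in finish₂ {⊥} {T} T⊆ few (m≤t+p large) (forget-flag {⊥} {T} {T′} T′⊆ cost cov′)
      where
      open L₂.Ranks T
      pool : DSet n
      mem pool h = g₂ M₁.≈ h ⊎ g₃ M₁.≈ h
      mem? pool h = (g₂ M₁.≈? h) ⊎-dec (g₃ M₁.≈? h)
      ≈₁⇒≈₂ : ∀ {x y} → x M₁.≈ y → x M₂.≈ y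
      ≈₁⇒≈₂ = Extend.≈⇒≈′ E₂
      near : ∀ {h} → h ∈ pool → g₂ M₂.≈ h
      near (inj₁ e) = ≈₁⇒≈₂ e
      near (inj₂ e) = M₂.≈-trans e₂₃ (≈₁⇒≈₂ e)
      far : ∀ {h} → h ∈ pool → h ∉ set₂
      far h∈ h∈₂ = g₂∉ (M₂.≈0⇒∈ (M₂.≈-trans (M₂.∈⇒≈0 h∈₂) (M₂.≈-sym (near h∈))))
      inS : ∀ {h} → h ∈ pool → h ∈ S
      inS (inj₁ e) = full₂ _ e
      inS (inj₂ e) = full₃ _ e
      pool⊆ : pool ⊆ T ∖ set₂
      pool⊆ h∈ = keep (inS h∈ , (λ h∈₁ → far h∈ (Extend.K⊆K′ E₂ h∈₁)))
                   (λ e → ne (M₂.≈-trans (≈₁⇒≈₂ e) (M₂.≈-sym (near h∈)))) , far h∈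
      pool-size : count pool ≡ p + p
      pool-size = trans (count-⊎ pool (M₁.coset g₂) (M₁.coset g₃) id inj₁ inj₂
                          (λ e f → ne₂₃ (M₁.≈-trans e (M₁.≈-sym f))))
                        (cong₂ _+_ (trans (M₁.count-coset g₂) order₁) (trans (M₁.count-coset g₃) order₁))
      room : p + length (slices (g₂ ∷ []) p) ≤ suc (count (L₂.inner T) + count pool)
      room = subst₂ (λ s t → p + s ≤ suc (count (L₂.inner T) + t))
               (sym (trans (length-slices (g₂ ∷ []) p) (*-identityˡ p))) (sym pool-size)
               (m≤n⇒m≤1+n (m≤n+m (p + p) (count (L₂.inner T))))

    Partner : Fin n → Fin n → Set
    Partner g h = g M₂.≈ h ⊗ ¬ (g M₁.≈ h) ⊗ FullIn S h

    partner? : ∀ g → Dec (∃ (Partner g))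
    partner? g = Fin.any? λ h → (g M₂.≈? h) ×-dec ¬? (g M₁.≈? h) ×-dec fullIn? S h

    ∉₂⇒∉₁ : ∀ {g} → g ∉ set₂ → g ∉ set₁
    ∉₂⇒∉₁ g∉ g∈ = g∉ (Extend.K⊆K′ E₂ g∈)

    -- Next to g, consider a second outer K₂-coset. If it has no full K₁-coset, it is the one with a
    -- slice to spare. If it has a single one, the first level is taken from that one instead of g,
    -- which destroys its fullness. If it has two, they are paired.
    solve-full : 2 * count (S ∩ set₂) < p * p → ∀ g → g ∉ set₂ → FullIn S g → Solved ⊥
    solve-full few g g∉ full =
      let (w , (_ , w∉) , ne) = another g g∉ in
      choose w w∉ ne (Fin.any? λ h → (w M₂.≈? h) ×-dec fullIn? S h)
      where
      lone : ∀ g → g ∉ set₂ → FullIn S g → ¬ ∃ (Partner g) → Solved ⊥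
      lone g g∉ full none = solve-gap few {g} (level-one-from g (∉₂⇒∉₁ g∉) full) g g∉
          λ {T} T⊆ (x , e , x∉) h g≈h fullT → decide T T⊆ x e x∉ h g≈h fullT (g M₁.≈? h)
        where
        decide : ∀ T → T ⊆ S → ∀ x → g M₁.≈ x → x ∉ T → ∀ h → g M₂.≈ h → FullIn T h → ¬ Dec (g M₁.≈ h)
        decide T T⊆ x e x∉ h g≈h fullT (yes f) = x∉ (fullT x (M₁.≈-trans (M₁.≈-sym f) e))
        decide T T⊆ x e x∉ h g≈h fullT (no ne) = none (h , g≈h , ne , λ x′ e′ → T⊆ (fullT x′ e′))
      choose : ∀ w → w ∉ set₂ → ¬ (g M₂.≈ w) → Dec (∃ λ h → w M₂.≈ h ⊗ FullIn S h) → Solved ⊥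
      choose w w∉ ne (no none) = solve-gap few {g} (level-one-from g (∉₂⇒∉₁ g∉) full) w w∉
        λ T⊆ _ h w≈h fullT → none (h , w≈h , λ x e → T⊆ (fullT x e))
      choose w w∉ ne (yes (g₂ , w≈g₂ , full₂)) = pair (partner? g₂)
        where
        g₂∉ : g₂ ∉ set₂
        g₂∉ g₂∈ = w∉ (M₂.≈0⇒∈ (M₂.≈-trans (M₂.∈⇒≈0 g₂∈) (M₂.≈-sym w≈g₂)))
        pair : Dec (∃ (Partner g₂)) → Solved ⊥
        pair (no none) = lone g₂ g₂∉ full₂ none
        pair (yes (g₃ , e , ne′ , full₃)) = solve-pair few {g} (level-one-from g (∉₂⇒∉₁ g∉) full) g₂ g₃ g₂∉ e ne′
          (λ f → ne (M₂.≈-trans f (M₂.≈-sym w≈g₂))) full₂ full₃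

    open NormalSubgroup K₂ using () renaming (0∈ to 0∈₂; ⊕∈ to ⊕∈₂; ⊖∈ to ⊖∈₂)

    annihilated : ∀ {x} → x ∈ set₂ → (p * p) × x ≡ 𝟘
    annihilated {x} x∈ = trans (sym (×-assocˡ x p p)) (Extend.annihilates E₁ (Extend.annihilates E₂ x∈))

    2∤pp : ¬ (2 ∣ p * p)
    2∤pp 2∣pp = 2∤n (∣-trans 2∣pp (divides m′ n≡pp))

    -- S ∪ {𝟘} fills more than half of K₂, so every element of K₂ is a sum of two distinct elements of it.
    dense-sums : p * p ≤ 2 * count (S ∩ set₂) → ∀ {y} → y ∈ set₂ → Reach ⊥ (S ∖ set₂) y
    dense-sums dense {y} y∈ =
      let (a , b , a∈ , b∈ , a≢b) = two-members (A ∩ B) two in pick a b a∈ b∈ a≢b (a Fin.≟ co a) (b Fin.≟ co b)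
      where
      co : Fin n → Fin n
      co a = ⊖ a ⊕ y
      A B : DSet n
      mem A a = a ≡ 𝟘 ⊎ a ∈ S ∩ set₂
      mem? A a = (a Fin.≟ 𝟘) ⊎-dec mem? (S ∩ set₂) a
      mem B a = co a ∈ A
      mem? B a = mem? A (co a)
      A⊆₂ : A ⊆ set₂
      A⊆₂ (inj₁ refl) = 0∈₂
      A⊆₂ (inj₂ (_ , a∈)) = a∈
      co-co : ∀ a → co (y ⊕ ⊖ a) ≡ a
      co-co a = trans (cong (_⊕ y) (trans (⁻¹-anti-homo-∙ y (⊖ a)) (cong (_⊕ ⊖ y) (⁻¹-involutive a)))) (//-rightDividesˡ y a)
      B⊆₂ : B ⊆ set₂
      B⊆₂ {a} a∈ = subst (_∈ set₂) (trans (cong (y ⊕_) (trans (⁻¹-anti-homo-∙ (⊖ a) y) (cong (⊖ y ⊕_) (⁻¹-involutive a)))) (\\-leftDividesˡ y a))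
                     (⊕∈₂ y∈ (⊖∈₂ (A⊆₂ a∈)))
      A≤B : count A ≤ count B
      A≤B = count-image A B (λ a → y ⊕ ⊖ a) (λ {a} {b} eq → trans (sym (co-co a)) (trans (cong co eq) (co-co b)))
              (λ {a} a∈ → subst (_∈ A) (sym (co-co a)) a∈)
      |A| : count A ≡ 1 + count (S ∩ set₂)
      |A| = trans (count-⊎ A ⟪ 𝟘 ∷ [] ⟫ (S ∩ set₂) (λ { (inj₁ eq) → inj₁ (here eq) ; (inj₂ h) → inj₂ h })
                    (λ { (here eq) → inj₁ eq }) inj₂ (λ { (here refl) (0∈S , _) → 0∉S 0∈S }))
                  (cong (_+ count (S ∩ set₂)) (count-list {xs = 𝟘 ∷ []} ([] ∷ [])))
      apart : count (A ∖ B) + count B ≤ p * p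
      apart = subst₂ _≤_ (count-⊎ (dset (λ a → a ∈ A ∖ B ⊎ a ∈ B) (λ a → mem? (A ∖ B) a ⊎-dec mem? B a)) (A ∖ B) B id inj₁ inj₂ (λ (_ , a∉) → a∉)) order₂
                (count-mono (dset (λ a → a ∈ A ∖ B ⊎ a ∈ B) (λ a → mem? (A ∖ B) a ⊎-dec mem? B a)) set₂
                  (λ { (inj₁ (a∈ , _)) → A⊆₂ a∈ ; (inj₂ a∈) → B⊆₂ a∈ }))
      two : 2 ≤ count (A ∩ B)
      two = two-bound (count A) (count (A ∩ B)) (count (A ∖ B)) (count B) (count (S ∩ set₂)) (p * p) (count-∖ A B) |A| A≤B apart dense
      usable : ∀ {a} → a ∈ A → a ≢ 𝟘 → a ∈ S ∖ (S ∖ set₂)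
      usable (inj₁ eq) ne = contradiction eq ne
      usable (inj₂ (a∈ , a∈₂)) _ = a∈ , λ (_ , a∉) → a∉ a∈₂
      sum : ∀ a → a ∈ A → co a ∈ A → a ≢ co a → Reach ⊥ (S ∖ set₂) y
      sum a a∈ b∈ a≢b = split (a Fin.≟ 𝟘) (co a Fin.≟ 𝟘)
        where
        total : a ⊕ co a ≡ y
        total = \\-leftDividesˡ a y
        -- 𝟘 belongs to A but not to S, so it is dropped from the sum; distinct summands are not
        -- both 𝟘.
        split : Dec (a ≡ 𝟘) → Dec (co a ≡ 𝟘) → Reach ⊥ (S ∖ set₂) y
        split (yes a≡0) (yes b≡0) = contradiction (trans a≡0 (sym b≡0)) a≢b
        split (yes a≡0) (no b≢0) = reached (co a ∷ []) (λ ()) ([] ∷ []) (usable b∈ b≢0 ∷ [])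
          (trans (identʳ (co a)) (trans (sym (identˡ _)) (trans (cong (_⊕ co a) (sym a≡0)) total)))
        split (no a≢0) (yes b≡0) = reached (a ∷ []) (λ ()) ([] ∷ []) (usable a∈ a≢0 ∷ [])
          (trans (cong (a ⊕_) (sym b≡0)) total)
        split (no a≢0) (no b≢0) = reached (a ∷ co a ∷ []) (λ ()) ((a≢b ∷ []) ∷ [] ∷ []) (usable a∈ a≢0 ∷ usable b∈ b≢0 ∷ [])
          (trans (cong (a ⊕_) (identʳ (co a))) total)
      -- At most one element a of K₂ satisfies a ⊕ a = y, because the order of K₂ is odd. So one of
      -- two distinct members of A ∩ B has a complement different from itself.
      pick : ∀ a b → a ∈ A ∩ B → b ∈ A ∩ B → a ≢ b → Dec (a ≡ co a) → Dec (b ≡ co b) → Reach ⊥ (S ∖ set₂) y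
      pick a b (a∈ , a′∈) _ _ (no ne) _ = sum a a∈ a′∈ ne
      pick a b _ (b∈ , b′∈) _ (yes _) (no ne) = sum b b∈ b′∈ ne
      pick a b (a∈ , _) (b∈ , _) a≢b (yes eq) (yes eq′) = contradiction
        (halve 2∤pp (annihilated (A⊆₂ a∈)) (annihilated (A⊆₂ b∈)) (trans (doubled eq) (sym (doubled eq′)))) a≢b
        where
        doubled : ∀ {a} → a ≡ co a → a ⊕ a ≡ y
        doubled {a} eq = trans (cong (a ⊕_) eq) (\\-leftDividesˡ a y)

    -- Sums of at most two elements fill K₂ at once, so the lossy first level is bypassed and all of
    -- S ∖ K₂ remains for the climb.
    solve-dense : p * p ≤ 2 * count (S ∩ set₂) → Solved ⊥
    solve-dense dense = climb₂ {⊥} {S ∖ set₂} proj₁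
        (𝟘 , λ y e → dense-sums dense (M₂.≈0⇒∈ e))
        (dense-bound m p (count S) (count (S ∩ set₂)) (count (S ∖ set₂)) (count ((S ∖ set₂) ∖ set₂)) S≥′ (count-∖ S set₂)
          (subst (count (S ∩ set₂) <_) order₂ (count-< (S ∩ set₂) set₂ proj₂ 0∈₂ (λ (0∈S , _) → 0∉S 0∈S)))
          (count-mono (S ∖ set₂) ((S ∖ set₂) ∖ set₂) (λ x∈ → x∈ , proj₂ x∈)))

    solve-divisible : Solved OnlyK₁
    solve-divisible = decide (p * p ≤? 2 * count (S ∩ set₂))
        (Fin.any? λ g → ¬? (mem? set₂ g) ×-dec fullIn? S g)
      where
      weaken : Solved ⊥ → Solved OnlyK₁
      weaken (T , f) = T , λ y → reach-mono ⊥-elim id (f y)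
      decide : Dec (p * p ≤ 2 * count (S ∩ set₂)) → Dec (∃ λ g → g ∉ set₂ ⊗ FullIn S g) → Solved OnlyK₁
      decide (yes dense) _ = weaken (solve-dense dense)
      decide (no sparse) (yes (g , g∉ , full)) = weaken (solve-full (≰⇒> sparse) g g∉ full)
      decide (no sparse) (no none) = solve-thin (≰⇒> sparse) λ g g∉ full → none (g , g∉ , full)

  solved : Solved OnlyK₁
  solved = decide (p ∣? m)
    where
    decide : Dec (p ∣ m) → Solved OnlyK₁
    decide (no p∤m) = solve-coprime p∤m
    decide (yes (divides m′ m≡)) = Divisible.solve-divisible (trans m≡ (*-comm m′ p))

  2∤p : ¬ (2 ∣ p)
  2∤p 2∣p = 2∤n (∣-trans 2∣p p∣n)

  -- The empty sum is only needed if S contains K₁ ∖ {𝟘}, and then 𝟘 = z ⊕ ⊖ z.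
  nonempty-sum : ∀ y → Σ (List (Fin n)) λ xs → xs ≢ [] ⊗ Unique xs ⊗ All (_∈ S) xs ⊗ sumL G xs ≡ y
  nonempty-sum y = let (T , f) = solved in go (f y)
    where
    go : ∀ {T} → Reach OnlyK₁ T y → Σ (List (Fin n)) λ xs → xs ≢ [] ⊗ Unique xs ⊗ All (_∈ S) xs ⊗ sumL G xs ≡ y
    go (reached xs@(_ ∷ _) _ u used s) = xs , (λ ()) , u , All.map proj₁ used , s
    go (reached [] flag _ _ s) = z ∷ ⊖ z ∷ [] , (λ ()) , ((z≢⊖z ∷ []) ∷ [] ∷ []) ,
        (proj₁ (inside₁ (Extend.z∈K′ E₁ , z∉)) ∷ proj₁ (inside₁ (⊖∈₁ (Extend.z∈K′ E₁) , λ ⊖z≡0 → z∉ (trans (sym (⁻¹-involutive z)) (trans (cong ⊖_ ⊖z≡0) ε⁻¹≈ε)))) ∷ []) ,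
        trans (cong (z ⊕_) (identʳ (⊖ z))) (trans (inverseʳ z) s)
      where
      open Extension E₁ using (z; z∉)
      open NormalSubgroup K₁ using () renaming (⊖∈ to ⊖∈₁)
      inside₁ : set₁ ∖ NormalSubgroup.set trivial ⊆ inner₀ S
      inside₁ = count-⊆-≡ (inner₀ S) (set₁ ∖ NormalSubgroup.set trivial) proj₂ (s≤s⁻¹ (begin
          suc (count (set₁ ∖ NormalSubgroup.set trivial))     ≤⟨ count-< (set₁ ∖ NormalSubgroup.set trivial) set₁ proj₁ (NormalSubgroup.0∈ K₁) (λ (_ , 0≢0) → 0≢0 refl) ⟩
          count set₁                                     ≡⟨ order₁ ⟩
          p                                              ≤⟨ proj₂ (flag refl) ⟩
          suc x₁ ∎))
        where open ≤-Reasoning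
      z≢⊖z : z ≢ ⊖ z
      z≢⊖z eq = z∉ (halve 2∤p (Extend.annihilates E₁ (Extend.z∈K′ E₁)) (Extend.annihilates E₁ (NormalSubgroup.0∈ K₁))
        (trans (cong (z ⊕_) eq) (trans (inverseʳ z) (sym (identˡ 𝟘)))))

-- Translation between `Subset` and decidable subsets

members : ∀ {n} → Subset n → List (Fin n)
members Vec.[] = []
members (true Vec.∷ S) = zero ∷ map suc (members S)
members (false Vec.∷ S) = map suc (members S)

length-members : ∀ {n} (S : Subset n) → length (members S) ≡ ∣ S ∣
length-members Vec.[] = refl
length-members (true Vec.∷ S) = cong suc (trans (List.length-map suc (members S)) (length-members S))
length-members (false Vec.∷ S) = trans (List.length-map suc (members S)) (length-members S)

members-! : ∀ {n} (S : Subset n) → Unique (members S)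
members-! Vec.[] = []
members-! (true Vec.∷ S) = All.map⁺ (All.tabulate λ _ ()) ∷ Unique.map⁺ Fin.suc-injective (members-! S)
members-! (false Vec.∷ S) = Unique.map⁺ Fin.suc-injective (members-! S)

members⁻ : ∀ {n} (S : Subset n) → All (_∈ˢ S) (members S)
members⁻ Vec.[] = []
members⁻ (true Vec.∷ S) = Vec.here ∷ All.map⁺ (All.map Vec.there (members⁻ S))
members⁻ (false Vec.∷ S) = All.map⁺ (All.map Vec.there (members⁻ S))

members⁺ : ∀ {n} {S : Subset n} {x} → x ∈ˢ S → x ∈ₗ members S
members⁺ {S = true Vec.∷ S} Vec.here = here refl
members⁺ {S = true Vec.∷ S} (Vec.there x∈) = there (Mem.∈-map⁺ suc (members⁺ x∈))
members⁺ {S = false Vec.∷ S} (Vec.there x∈) = Mem.∈-map⁺ suc (members⁺ x∈)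

fromSubset : ∀ {n} → Subset n → DSet n
mem (fromSubset S) x = x ∈ˢ S
mem? (fromSubset S) x = x Subset.∈? S

∣∣≤count : ∀ {n} (S : Subset n) → ∣ S ∣ ≤ count (fromSubset S)
∣∣≤count S = subst (_≤ count (fromSubset S)) (length-members S) (length≤count (fromSubset S) (members-! S) (members⁻ S))

toSubset : ∀ {n} → DSet n → Subset n
toSubset P = Vec.tabulate λ x → does (mem? P x)

∈-toSubset⁺ : ∀ {n} (P : DSet n) {x} → x ∈ P → x ∈ˢ toSubset P
∈-toSubset⁺ P {x} x∈ = Vec.lookup⇒[]= x _ (trans (Vec.lookup∘tabulate _ x) (dec-true (mem? P x) x∈))

∈-toSubset⁻ : ∀ {n} (P : DSet n) {x} → x ∈ˢ toSubset P → x ∈ P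
∈-toSubset⁻ P {x} x∈ with mem? P x in eq
... | yes p = p
... | no _ = contradiction (trans (sym (Vec.[]=⇒lookup x∈)) (trans (Vec.lookup∘tabulate _ x) (cong does eq))) λ ()

count≤∣∣ : ∀ {n} (P : DSet n) → count P ≤ ∣ toSubset P ∣
count≤∣∣ P = subst (count P ≤_) (length-members (toSubset P))
  (unique-⊆⇒length≤ (elems-! P) (λ x∈ → members⁺ (∈-toSubset⁺ P (elems⁻ P x∈))))

-- The lower bound

module LowerBound {n : ℕ} (G : FiniteGroup n) (nil : Nilpotent G) where
  open FiniteGroup G
  open GroupTheory G
  open NilpotentGroups G

  -- Each step of the central series uses a prime factor of d / |K|, so the order remains a divisor
  -- of d until it equals d.
  subgroup-of-order : ∀ {d} → d ∣ n → Σ NormalSubgroup λ K → NormalSubgroup.order K ≡ d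
  subgroup-of-order {d} d∣n = go d trivial (m∸n≤m d (NormalSubgroup.order trivial)) (subst (_∣ d) (sym order-trivial) (1∣ d))
    where
    d>0 : 0 < d
    d>0 = n≢0⇒n>0 λ { refl → <-irrefl (sym (0∣⇒≡0 d∣n)) n>0 }
    go : ∀ fuel K → d ∸ NormalSubgroup.order K ≤ fuel → NormalSubgroup.order K ∣ d → Σ NormalSubgroup λ K → NormalSubgroup.order K ≡ d
    go fuel K le (divides u d≡) with u ≤? 1
    ... | yes u≤1 = K , ≤-antisym (∣⇒≤ ⦃ >-nonZero d>0 ⦄ (divides u d≡))
            (≤-trans (≤-reflexive d≡) (≤-trans (*-monoˡ-≤ (NormalSubgroup.order K) u≤1) (≤-reflexive (*-identityˡ _))))
    ... | no u≰1 with prime-factor u (≰⇒> u≰1) | fuel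
    ... | q , pq , divides v u≡ | fuel = next fuel le
      where
      open NormalSubgroup K
      d≡′ : d ≡ v * (q * order)
      d≡′ = trans d≡ (trans (cong (_* order) u≡) (*-assoc v q order))
      E : Extension K q
      E = extension nil K q pq (∣-trans (divides v d≡′) d∣n)
      open Extend E
      order′∣d : count set′ ∣ d
      order′∣d = divides v (trans d≡′ (cong (v *_) (sym order′)))
      bigger : order < count set′
      bigger = subst (order <_) (sym order′) (m<k*m (order>0 K) (nonTrivial⇒n>1 q ⦃ prime⇒nonTrivial pq ⦄))
      decrease : d ∸ count set′ < d ∸ order
      decrease = ∸-monoʳ-< bigger (∣⇒≤ ⦃ >-nonZero d>0 ⦄ order′∣d)
      next : ∀ fuel → d ∸ order ≤ fuel → Σ NormalSubgroup λ K → NormalSubgroup.order K ≡ d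
      next zero le = contradiction (≤-trans decrease le) λ ()
      next (suc fuel) le = go fuel K′ (s≤s⁻¹ (≤-trans decrease le)) order′∣d

  module _ {p m : ℕ} (pp : Prime p) (p≤m : p ≤ m) (N : NormalSubgroup) (order≡ : NormalSubgroup.order N ≡ m) (E : Extension N p) where

    -- Modulo N a sum of distinct elements of S is j × z, where j counts the summands from `qs`. As
    -- j ≤ p - 2, the element (p - 1) × z is out of reach. The set has (m - 1) + (p - 2) elements; p
    -- ≤ m ensures that the coset of z can supply p - 2 of them.
    not-critical-from : ∀ t → t < m + p ∸ 2 → ¬ CritProp G t
    not-critical-from t t< crit =
      let (xs , _ , u , all , s) = crit (toSubset S) (λ h → 0∉S (∈-toSubset⁻ S h)) large ((p ∸ 1) × z)
          (j , j< , e) = sums xs u (All.map (∈-toSubset⁻ S) all)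
      in ×z-injective j< (≤-reflexive (suc-pred p)) (subst (j × z ≈_) s e)
      where
      instance
        p≢0 : NonZero p
        p≢0 = prime⇒nonZero pp
      p≥2 : 2 ≤ p
      p≥2 = nonTrivial⇒n>1 p ⦃ prime⇒nonTrivial pp ⦄
      open NormalSubgroup N
      open Extension E using (z; z∉)
      open Extend E using (×z-injective)
      open Mod N
      qs : List (Fin n)
      qs = take (p ∸ 2) (elems (coset z))
      qs⊆ : ∀ {x} → x ∈ₗ qs → z ≈ x
      qs⊆ x∈ = elems⁻ (coset z) (∈-take (p ∸ 2) x∈)
      length-qs : length qs ≡ p ∸ 2
      length-qs = trans (List.length-take (p ∸ 2) _) (m≤n⇒m⊓n≡m (≤-trans (m∸n≤m p 2)
        (≤-trans p≤m (≤-reflexive (sym (trans (count-coset z) order≡))))))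
      S : DSet n
      mem S x = x ∈ set ∖ ⟪ 𝟘 ∷ [] ⟫ ⊎ x ∈ₗ qs
      mem? S x = mem? (set ∖ ⟪ 𝟘 ∷ [] ⟫) x ⊎-dec mem? ⟪ qs ⟫ x
      z≉ : ∀ {x} → z ≈ x → x ∉ set
      z≉ e x∈ = z∉ (≈0⇒∈ (≈-trans (∈⇒≈0 x∈) (≈-sym e)))
      0∉S : 𝟘 ∉ S
      0∉S (inj₁ (_ , 𝟘∉)) = 𝟘∉ (here refl)
      0∉S (inj₂ h) = z≉ (qs⊆ h) 0∈
      size : suc (count S) ≡ m + (p ∸ 2)
      size = begin
          suc (count S)                                               ≡⟨ cong suc (count-⊎ S (set ∖ ⟪ 𝟘 ∷ [] ⟫) ⟪ qs ⟫ id inj₁ inj₂ (λ (x∈ , _) h → z≉ (qs⊆ h) x∈)) ⟩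
          suc (count (set ∖ ⟪ 𝟘 ∷ [] ⟫) + count ⟪ qs ⟫)               ≡⟨ cong (λ t → t + count (set ∖ ⟪ 𝟘 ∷ [] ⟫) + count ⟪ qs ⟫) zero-size ⟨
          count (set ∩ ⟪ 𝟘 ∷ [] ⟫) + count (set ∖ ⟪ 𝟘 ∷ [] ⟫) + count ⟪ qs ⟫ ≡⟨ cong (_+ count ⟪ qs ⟫) (count-∖ set ⟪ 𝟘 ∷ [] ⟫) ⟨
          order + count ⟪ qs ⟫                                        ≡⟨ cong₂ _+_ order≡ (trans (count-list (Unique.take⁺ (p ∸ 2) (elems-! (coset z)))) length-qs) ⟩
          m + (p ∸ 2) ∎
        where
        open ≡-Reasoning
        zero-size : count (set ∩ ⟪ 𝟘 ∷ [] ⟫) ≡ 1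
        zero-size = trans (count-cong (set ∩ ⟪ 𝟘 ∷ [] ⟫) ⟪ 𝟘 ∷ [] ⟫ proj₂ (λ { (here refl) → 0∈ , here refl }))
                          (count-list {xs = 𝟘 ∷ []} ([] ∷ []))
      large : t ≤ ∣ toSubset S ∣
      large = ≤-trans (s≤s⁻¹ (≤-trans t< (≤-reflexive (trans (+-∸-assoc m p≥2) (sym size))))) (count≤∣∣ S)
      sums-count : ∀ xs → All (_∈ S) xs → length (filter (mem? ⟪ qs ⟫) xs) × z ≈ sumL G xs
      sums-count [] [] = ≈-refl
      sums-count (x ∷ xs) (x∈ ∷ all) with ih ← sums-count xs all | mem? ⟪ qs ⟫ x | x∈
      ... | yes x∈qs | _ = ⊕-cong (qs⊆ x∈qs) ih
      ... | no x∉qs | inj₁ (x∈N , _) = ≈-trans ih (≈-trans (≡⇒≈ (sym (identˡ _))) (⊕-cong (∈⇒≈0 x∈N) ≈-refl))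
      ... | no x∉qs | inj₂ x∈qs = contradiction x∈qs x∉qs
      sums : ∀ xs → Unique xs → All (_∈ S) xs → ∃ λ j → j < p ∸ 1 ⊗ j × z ≈ sumL G xs
      sums xs u all = length (filter (mem? ⟪ qs ⟫) xs) , bound , sums-count xs all
        where
        bound : length (filter (mem? ⟪ qs ⟫) xs) < p ∸ 1
        bound = ≤-trans (s≤s (≤-trans (unique-⊆⇒length≤ (Unique.filter⁺ (mem? ⟪ qs ⟫) u)
                  (λ x∈ → proj₂ (Mem.∈-filter⁻ (mem? ⟪ qs ⟫) {xs = xs} x∈))) (≤-reflexive length-qs)))
                  (≤-reflexive (sym (+-∸-assoc 1 p≥2)))

  not-critical : ∀ {p m} → Prime p → n ≡ p * m → p ≤ m → ∀ t → t < m + p ∸ 2 → ¬ CritProp G t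
  not-critical {p} {m} pp n≡pm p≤m =
    let (N , order≡) = subgroup-of-order (subst (m ∣_) (sym n≡pm) (n∣m*n p))
    in not-critical-from pp p≤m N order≡ (extension nil N p pp (subst₂ (λ s t → p * s ∣ t) (sym order≡) (sym n≡pm) ∣-refl))

theorem1p2 : ∀ (n : ℕ) (G : FiniteGroup n) → Nilpotent G → ¬ (2 ∣ n)
    → ∀ (p m : ℕ) → Prime p → n ≡ p * m → (∀ q → Prime q → q ∣ n → p ≤ q)
    → Composite m → CriticalNumberIs G (m + p ∸ 2)
theorem1p2 n G nil 2∤n p m pp n≡pm smallest cm = upper , LowerBound.not-critical G nil pp n≡pm p≤m
  where
  upper : CritProp G (m + p ∸ 2)
  upper S 0∉S large g with UpperBound.nonempty-sum G nil 2∤n pp n≡pm smallest cm (fromSubset S) 0∉S (≤-trans large (∣∣≤count S)) g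
  ... | [] , xs≢[] , _ = contradiction refl xs≢[]
  ... | x ∷ xs , _ , u , all , s = x ∷ xs , _ , u , all , s
  p≤m : p ≤ m
  p≤m = let (a , b , 1<a , _ , m≡) = composite-factors cm
            (q , pq , q∣a) = prime-factor a 1<a
            q∣m = ∣-trans q∣a (subst (a ∣_) (sym m≡) (m∣m*n b))
        in ≤-trans (smallest q pq (∣-trans q∣m (subst (m ∣_) (sym n≡pm) (n∣m*n p)))) (∣⇒≤ ⦃ composite⇒nonZero cm ⦄ q∣m)
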